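{- Let $s$ and $t$ be real parameters, and consider the functions $g^{(s)}_{\mathrm{bc-m}}, g^{(t)}_{\mathrm{bc-m}}\in\widetilde{\mathcal{G}}_{\mathrm{c-m}}$. For every $n\ge1$ and $\pi\in NC(n)$ one has $$ \bigl(g^{(s)}_{\mathrm{bc-m}}*(g^{(t)}_{\mathrm{bc-m}})^{ -1}\bigr)(\pi,1_n)=\begin{cases}(s-t)^{|\pi|-1}, & \text{if } \pi \text{ is irreducible},\\ 0, & \text{otherwise}.\end{cases} $$
   Context: For $n \ge 1$, $NC(n)$ is the set of non-crossing partitions of $\{1,\ldots,n\}$, partially ordered by reverse refinement: $\pi \le \sigma$ iff every block of $\sigma$ is a union of blocks of $\pi$. $1_n \in NC(n)$ is the partition with a single block; $|\pi|$ is the number of blocks of $\pi$; $\pi\in NC(n)$ is irreducible if $1$ and $n$ belong to the same block of $\pi$. A block $V$ of $\pi$ is inner if there is a block $W$ of $\pi$ with $\min W < \min V \le \max V < \max W$; $\mathrm{inner}(\pi)$ is the number of inner blocks of $\pi$. Put $NC^{(2)} := \sqcup_{n=1}^{\infty} \{ (\pi,\sigma) \mid \pi,\sigma \in NC(n),\ \pi \le \sigma \}$. For $\pi \in NC(n)$ and a non-empty $W = \{p_1 < \cdots < p_m\} \subseteq \{1,\ldots,n\}$, $\pi_W \in NC(m)$ is the partition for which $i,j$ are in the same block of $\pi_W$ iff $p_i,p_j$ are in the same block of $\pi$. $\widetilde{\mathcal{G}}$ is the set of functions $g : NC^{(2)} \to \mathbb{C}$ such that $g(\pi,\pi)=1$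 for all $\pi$ and $g(\pi,\sigma) = \prod_{W \in \sigma} g(\pi_W, 1_{|W|})$ for every $n \ge 1$ and $\pi \le \sigma$ in $NC(n)$. It is a group under convolution, $(f*g)(\pi,\sigma) = \sum_{\rho:\ \pi \le \rho \le \sigma} f(\pi,\rho) g(\rho,\sigma)$; $g^{ -1}$ is the inverse under convolution. A function $g \in \widetilde{\mathcal{G}}$ is uniquely determined by its values $g(\pi,1_n)$, and these can be prescribed arbitrarily for $\pi \in NC(n)\setminus\{1_n\}$, $n \ge 1$. $\widetilde{\mathcal{G}}_{\mathrm{c-m}}$ is the set of $g\in\widetilde{\mathcal{G}}$ with $g(\pi_1\diamond\pi_2,1_{n_1+n_2})=g(\pi_1,1_{n_1})g(\pi_2,1_{n_2})$ for all $\pi_i\in NC(n_i)$, where $\pi_1\diamond\pi_2\in NC(n_1+n_2)$ is the concatenation ($\pi_1$ placed on $1,\ldots,n_1$ and $\pi_2$ on $n_1+1,\ldots,n_1+n_2$). For $t\in\mathbb{R}$, $g^{(t)}_{\mathrm{bc-m}}$ is the unique function in $\widetilde{\mathcal{G}}$ such that $g^{(t)}_{\mathrm{bc-m}}(\pi,1_n)=t^{\mathrm{inner}(\pi)}$ for all $n\ge1$, $\pi\in NC(n)$; it belongs to $\widetilde{\mathcal{G}}_{\mathrm{c-m}}$. Convention: $0^0=1$. -}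

module Defs where

open import Algebra.Bundles using (CommutativeRing)
import Algebra.Properties.Semiring.Exp as Exp
open import Data.Bool.Base using (true; false; if_then_else_)
import Data.Bool.Properties as Bool
open import Data.Fin.Base as Fin using (Fin; zero; suc; fromℕ)
import Data.Fin.Properties as Fin
open import Data.Fin.Subset
  using (Subset; inside; outside; _∈_; _⊆_; ⊤; ∣_∣)
open import Data.Fin.Subset.Properties using (_∈?_; _⊆?_; ∈⊤)
open import Data.List.Base as List
  using (List; []; _∷_; foldr; filter; length; deduplicate; mapMaybe;
         cartesianProductWith)

open import Data.List.Relation.Unary.All as All using (All)
open import Data.List.Relation.Unary.Any as Any using (Any)
open import Data.Maybe.Base using (Maybe; just; nothing)
import Data.Nat.Base as ℕ
open import Data.Nat.Base using (ℕ; NonZero)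
open import Data.Product.Base using (∃; _×_; _,_)
open import Data.Vec.Base as Vec
  using (Vec; lookup; tabulate; replicate; toList)
open import Data.Vec.Properties
  using (≡-dec; lookup∘tabulate; lookup-replicate;
         []=⇒lookup; lookup⇒[]=)
open import Level using (Level)
open import Relation.Binary.Definitions using (DecidableEquality)
open import Relation.Binary.PropositionalEquality
  using (_≡_; refl; sym; trans; cong; subst)
open import Relation.Nullary.Decidable
  using (Dec; yes; no; does; _×-dec_; _→-dec_; map′; recompute)

private
  variable
    m n : ℕ

------------------------------------------------------------------------
-- Non-crossing partitions

_≟ˢ_ : DecidableEquality (Subset n)
_≟ˢ_ = ≡-dec Bool._≟_

-- A family b of subsets of Fin n is read as "lookup b i is the block
-- containing i".

IsPartition : Vec (Subset n) n → Set
IsPartition b =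
  (∀ i → i ∈ lookup b i) ×
  (∀ i j → j ∈ lookup b i → lookup b j ≡ lookup b i)

IsNonCrossing : Vec (Subset n) n → Set
IsNonCrossing b = ∀ i j k l → i Fin.< j → j Fin.< k → k Fin.< l →
  k ∈ lookup b i → l ∈ lookup b j → lookup b i ≡ lookup b j

IsNC : Vec (Subset n) n → Set
IsNC b = IsPartition b × IsNonCrossing b

isNC? : (b : Vec (Subset n) n) → Dec (IsNC b)
isNC? b =
  (Fin.all? (λ i → i ∈? lookup b i) ×-dec
   Fin.all? (λ i → Fin.all? λ j →
     (j ∈? lookup b i) →-dec (lookup b j ≟ˢ lookup b i))) ×-dec
  Fin.all? (λ i → Fin.all? λ j → Fin.all? λ k → Fin.all? λ l →
    (i Fin.<? j) →-dec (j Fin.<? k) →-dec (k Fin.<? l) →-dec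
    (k ∈? lookup b i) →-dec (l ∈? lookup b j) →-dec
    (lookup b i ≟ˢ lookup b j))

-- The proof is irrelevant and the blocks are stored as vectors, so
-- propositional equality of elements of NC n is equality of partitions.
-- NC 0 contains just the empty partition.

record NC (n : ℕ) : Set where
  constructor mkNC
  field
    classes : Vec (Subset n) n
    .isNC   : IsNC classes

  block : Fin n → Subset n
  block = lookup classes

open NC public using (classes; block)

NC-isNC : (π : NC n) → IsNC (classes π)
NC-isNC (mkNC b p) = recompute (isNC? b) p

_≟ᴺ_ : DecidableEquality (NC n)
mkNC b _ ≟ᴺ mkNC c _ =
  map′ (λ { refl → refl }) (cong classes) (≡-dec _≟ˢ_ b c)

blocks : NC n → List (Subset n)
blocks π = deduplicate _≟ˢ_ (toList (classes π))

#blocks : NC n → ℕ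
#blocks π = length (blocks π)

infix 4 _≤_ _≤?_

-- Every block W of σ is a union of blocks of π, that is, the block of π
-- through any point of W is contained in W.

_≤_ : NC n → NC n → Set
π ≤ σ = All (λ W → ∀ i → i ∈ W → block π i ⊆ W) (blocks σ)

_≤?_ : (π σ : NC n) → Dec (π ≤ σ)
π ≤? σ =
  All.all? (λ W → Fin.all? λ i → (i ∈? W) →-dec (block π i ⊆? W)) (blocks σ)

1ₙ : NC n
1ₙ {n} = mkNC (replicate n ⊤) (((λ i → full i i) , λ i j _ → same j i) ,
                                λ i j _ _ _ _ _ _ _ → same i j)
  where
  same : ∀ i j → lookup (replicate n ⊤) i ≡ lookup (replicate n (⊤ {n})) j
  same i j = trans (lookup-replicate i ⊤) (sym (lookup-replicate j ⊤))
  full : ∀ i j → j ∈ lookup (replicate n ⊤) i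
  full i j = subst (j ∈_) (sym (lookup-replicate i ⊤)) ∈⊤

∈-blocks-1ₙ : ∀ xs → All (_≡ ⊤) xs → All (_≡ ⊤ {n}) (deduplicate _≟ˢ_ xs)
∈-blocks-1ₙ [] All.[] = All.[]
∈-blocks-1ₙ (x ∷ xs) (p All.∷ ps) = p All.∷ filter⁺ _ (∈-blocks-1ₙ xs ps)
  where open import Data.List.Relation.Unary.All.Properties using (filter⁺)

all-replicate : ∀ m → All (_≡ ⊤ {n}) (toList (replicate m ⊤))
all-replicate ℕ.zero = All.[]
all-replicate (ℕ.suc m) = refl All.∷ all-replicate m

≤-1ₙ : (π : NC n) → π ≤ 1ₙ
≤-1ₙ {n} π =
  All.map (λ { refl _ _ _ → ∈⊤ }) (∈-blocks-1ₙ _ (all-replicate n))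

_IsMinOf_ _IsMaxOf_ : Fin n → Subset n → Set
a IsMinOf V = a ∈ V × (∀ i → i ∈ V → a Fin.≤ i)
a IsMaxOf V = a ∈ V × (∀ i → i ∈ V → i Fin.≤ a)

Encloses : Subset n → Subset n → Set
Encloses W V = ∃ λ a → ∃ λ b → ∃ λ c → ∃ λ d →
  (a IsMinOf W × b IsMinOf V × c IsMaxOf V × d IsMaxOf W) ×
  (a Fin.< b × b Fin.≤ c × c Fin.< d)

IsInner : NC n → Subset n → Set
IsInner π V = Any (λ W → Encloses W V) (blocks π)

isInner? : (π : NC n) (V : Subset n) → Dec (IsInner π V)
isInner? π V = Any.any? (λ W → Fin.any? λ a → Fin.any? λ b → Fin.any? λ c →
  Fin.any? λ d →
    (min? a W ×-dec min? b V ×-dec max? c V ×-dec max? d W) ×-dec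
    ((a Fin.<? b) ×-dec (b Fin.≤? c) ×-dec (c Fin.<? d))) (blocks π)
  where
  min? : ∀ a V → Dec (a IsMinOf V)
  min? a V = (a ∈? V) ×-dec Fin.all? λ i → (i ∈? V) →-dec (a Fin.≤? i)
  max? : ∀ a V → Dec (a IsMaxOf V)
  max? a V = (a ∈? V) ×-dec Fin.all? λ i → (i ∈? V) →-dec (i Fin.≤? a)

inner : NC n → ℕ
inner π = length (filter (isInner? π) (blocks π))

Irreducible : NC (ℕ.suc n) → Set
Irreducible {n} π = fromℕ n ∈ block π zero

irreducible? : (π : NC (ℕ.suc n)) → Dec (Irreducible π)
irreducible? {n} π = fromℕ n ∈? block π zero

------------------------------------------------------------------------
-- Restriction of a partition to a subset

-- The increasing enumeration p₁ < ⋯ < pₘ of W.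

point : (W : Subset n) → Fin ∣ W ∣ → Fin n
point (inside  Vec.∷ W) zero    = zero
point (inside  Vec.∷ W) (suc i) = suc (point W i)
point (outside Vec.∷ W) i       = suc (point W i)

point-mono-< : (W : Subset n) {i j : Fin ∣ W ∣} →
               i Fin.< j → point W i Fin.< point W j
point-mono-< (inside  Vec.∷ W) {zero}  {suc j} _           = ℕ.z<s
point-mono-< (inside  Vec.∷ W) {suc i} {suc j} (ℕ.s<s i<j) =
  ℕ.s<s (point-mono-< W i<j)
point-mono-< (outside Vec.∷ W) i<j = ℕ.s<s (point-mono-< W i<j)

preimage : (Fin m → Fin n) → Subset n → Subset m
preimage f V = tabulate λ i → lookup V (f i)

module _ (f : Fin m → Fin n) (V : Subset n) where
  ∈-preimage⁺ : ∀ {i} → f i ∈ V → i ∈ preimage f V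
  ∈-preimage⁺ {i} p =
    lookup⇒[]= i _ (trans (lookup∘tabulate _ i) ([]=⇒lookup p))

  ∈-preimage⁻ : ∀ {i} → i ∈ preimage f V → f i ∈ V
  ∈-preimage⁻ {i} p =
    lookup⇒[]= (f i) _ (trans (sym (lookup∘tabulate _ i)) ([]=⇒lookup p))

pullback : (Fin m → Fin n) → Vec (Subset n) n → Vec (Subset m) m
pullback f b = tabulate λ i → preimage f (lookup b (f i))

pullback-isNC : (f : Fin m → Fin n) →
                (∀ {i j} → i Fin.< j → f i Fin.< f j) →
                ∀ b → IsNC b → IsNC (pullback f b)
pullback-isNC f mono b ((here , same) , nc) =
  ( (λ i → subst (i ∈_) (sym (at i)) (∈-preimage⁺ f _ (here (f i))))
  , λ i j p → eq (same (f i) (f j) (down p)) ) ,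
  λ i j k l i<j j<k k<l p q →
    eq (nc _ _ _ _ (mono i<j) (mono j<k) (mono k<l) (down p) (down q))
  where
  at : ∀ i → lookup (pullback f b) i ≡ preimage f (lookup b (f i))
  at i = lookup∘tabulate _ i
  down : ∀ {i j} → j ∈ lookup (pullback f b) i → f j ∈ lookup b (f i)
  down {i} {j} p = ∈-preimage⁻ f _ (subst (j ∈_) (at i) p)
  eq : ∀ {i j} → lookup b (f i) ≡ lookup b (f j) →
       lookup (pullback f b) i ≡ lookup (pullback f b) j
  eq {i} {j} e = trans (at i) (trans (cong (preimage f) e) (sym (at j)))

-- i and j are in the same block of π ↾ W iff point W i and point W j are
-- in the same block of π.

_↾_ : NC n → (W : Subset n) → NC ∣ W ∣
mkNC b p ↾ W =
  mkNC (pullback (point W) b) (pullback-isNC (point W) (point-mono-< W) b p)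

------------------------------------------------------------------------
-- Enumeration of NC n

vectors : ∀ {a} {A : Set a} → List A → (n : ℕ) → List (Vec A n)
vectors xs ℕ.zero    = Vec.[] ∷ []
vectors xs (ℕ.suc n) = cartesianProductWith Vec._∷_ xs (vectors xs n)

toNC : (b : Vec (Subset n) n) → Dec (IsNC b) → Maybe (NC n)
toNC b (yes p) = just (mkNC b p)
toNC b (no _)  = nothing

allNC : (n : ℕ) → List (NC n)
allNC n = mapMaybe (λ b → toNC b (isNC? b))
                   (vectors (vectors (inside ∷ outside ∷ []) n) n)

------------------------------------------------------------------------
-- Functions on pairs π ≤ σ, with values in a commutative ring

module Functions {c ℓ : Level} (R : CommutativeRing c ℓ) where

  open CommutativeRing R
    using (Carrier; _≈_; _+_; _*_; 0#; 1#; semiring)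
  open Exp semiring public using (_^_)

  ∑ ∏ : ∀ {a} {A : Set a} → List A → (A → Carrier) → Carrier
  ∑ xs f = foldr (λ x s → f x + s) 0# xs
  ∏ xs f = foldr (λ x s → f x * s) 1# xs

  -- Such functions also have a value at the pair of empty partitions.
  -- It is unconstrained and plays no role: convolution preserves the
  -- size n, blocks are nonempty, and all conditions below concern n ≥ 1.

  Fun : Set c
  Fun = ∀ {n} (π σ : NC n) → .(π ≤ σ) → Carrier

  infix 4 _≗_

  _≗_ : Fun → Fun → Set ℓ
  f ≗ g = ∀ {n} .{{_ : NonZero n}} (π σ : NC n) .(π≤σ : π ≤ σ) →
          f π σ π≤σ ≈ g π σ π≤σ

  infixl 7 _⋆_

  ⋆-term : Fun → Fun → ∀ {n} (π ρ σ : NC n) →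
           Dec (π ≤ ρ) → Dec (ρ ≤ σ) → Carrier
  ⋆-term f g π ρ σ (yes π≤ρ) (yes ρ≤σ) = f π ρ π≤ρ * g ρ σ ρ≤σ
  ⋆-term f g π ρ σ _         _         = 0#

  _⋆_ : Fun → Fun → Fun
  (f ⋆ g) {n} π σ _ = ∑ (allNC n) λ ρ → ⋆-term f g π ρ σ (π ≤? ρ) (ρ ≤? σ)

  δ : Fun
  δ π σ _ = if does (π ≟ᴺ σ) then 1# else 0#

  _IsInverseOf_ : Fun → Fun → Set ℓ
  h IsInverseOf g = (h ⋆ g ≗ δ) × (g ⋆ h ≗ δ)

  -- Membership in 𝒢̃.

  record IsMultiplicative (g : Fun) : Set ℓ where
    field
      diagonal : ∀ {n} .{{_ : NonZero n}} (π : NC n) .(π≤π : π ≤ π) →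
                 g π π π≤π ≈ 1#
      factors  : ∀ {n} .{{_ : NonZero n}} (π σ : NC n) .(π≤σ : π ≤ σ) →
                 g π σ π≤σ ≈ ∏ (blocks σ) λ W → g (π ↾ W) 1ₙ (≤-1ₙ (π ↾ W))

  -- The property characterising the function g_{bc-m}^{(t)} from
  -- t-Boolean cumulants to moments.

  record IsBooleanCumulantToMoment (t : Carrier) (g : Fun) : Set ℓ where
    field
      isMultiplicative : IsMultiplicative g
      top-value        : ∀ {n} .{{_ : NonZero n}} (π : NC n) →
                         g π 1ₙ (≤-1ₙ π) ≈ t ^ inner π

{-# OPTIONS --safe #-}

-- Put u = s - t, and let q(π,ρ) = u^(|π|-|ρ|) if π ≤ ρ and the minimum and
-- the maximum of each block of ρ lie in one block of π, and q(π,ρ) = 0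
-- otherwise. The value q(π,1ₙ) is the right-hand side of the theorem, so by
-- associativity it is enough to show q ⋆ gₜ = gₛ.
--
-- Represent blocks by their minima. Both gₛ(π,σ) and gₜ(ρ,σ) are powers whose
-- exponent is the number of blocks that are inner within their block of σ.
-- If q(π,ρ) ≠ 0, passing from π to ρ merges some of these blocks of π into
-- blocks that surround them, and the ρ between π and σ with q(π,ρ) ≠ 0
-- correspond bijectively to the sets A of merged blocks. Each inner block thus
-- contributes u if merged and t if kept, and the sum over A is the expansion of
-- a product with one factor u + t = s per inner block.

module Submission where

open import Algebra.Bundles using (CommutativeMonoid; CommutativeRing)
import Algebra.Properties.CommutativeSemigroup as CommutativeSemigroupProperties
open import Data.Bool.Base using (Bool; true; false; if_then_else_)
open import Data.Fin.Base as Fin using (Fin; zero; suc; fromℕ)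
import Data.Fin.Properties as Fin
open import Data.Fin.Subset using (Subset; inside; outside; _∈_; _⊆_; ⊤; ∣_∣)
open import Data.Fin.Subset.Properties using (_∈?_; ⊆-antisym; ∈⊤)
open import Data.List.Base as List
  using (List; []; _∷_; _++_; foldr; filter; length; map; mapMaybe; allFin;
         cartesianProductWith)
open import Data.List.Membership.Propositional using (find; lose) renaming (_∈_ to _∈ˡ_)
open import Data.List.Membership.Propositional.Properties
  using (∈-allFin; ∈-cartesianProductWith⁺; ∈-deduplicate⁺; ∈-deduplicate⁻)
open import Data.List.Relation.Unary.All as All using ([]; _∷_)
open import Data.List.Relation.Unary.AllPairs using ([]; _∷_)
open import Data.List.Relation.Unary.Any using (here; there)
open import Data.List.Relation.Unary.Unique.Propositional using (Unique)
open import Data.List.Relation.Unary.Unique.Propositional.Properties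
  using (allFin⁺; cartesianProductWith⁺)
import Data.List.Relation.Unary.Unique.DecPropositional.Properties as DecUnique
open import Data.Maybe.Base using (Maybe; just; nothing; maybe′)
open import Data.Nat.Base as ℕ using (ℕ; zero; suc; z≤n; s≤s; NonZero; _∸_)
import Data.Nat.Properties as ℕ
open import Data.Product.Base using (∃; ∃₂; _×_; _,_; proj₁; proj₂)
open import Data.Sum.Base using (_⊎_; inj₁; inj₂)
open import Data.Vec.Base as Vec using (Vec; lookup; tabulate; toList)
open import Data.Vec.Membership.Propositional.Properties
  using (∈-lookup; ∈-toList⁺; ∈-toList⁻)
open import Data.Vec.Properties
  using (lookup∘tabulate; tabulate∘lookup; tabulate-cong; lookup-replicate;
         []=⇒lookup; lookup⇒[]=; ∷-injective)
import Data.Vec.Relation.Unary.Any as VecAny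
import Data.Vec.Relation.Unary.Any.Properties as VecAny
open import Function.Base using (_∘_; id)
open import Function.Bundles using (_⇔_; mk⇔)
open import Level using (Level)
open import Relation.Binary.Definitions using (tri<; tri≈; tri>)
open import Relation.Binary.PropositionalEquality
  using (_≡_; _≢_; refl; sym; trans; cong; subst)
open import Relation.Nullary.Decidable
  using (Dec; yes; no; does; _×-dec_; _→-dec_; ¬?; map′; dec-true; dec-false;
         does-⇔; decidable-stable; recompute)
open import Relation.Nullary.Negation using (¬_; contradiction)
open import Relation.Nullary.Negation.Core using (contradiction-irr)
open import Relation.Unary using (Pred; Decidable)
open import Defs

private
  variable
    a b p : Level
    A : Set a
    B : Set b
    n : ℕ

-- Finite sums and products, treated together as folds in a commutative monoid.

module Fold {c ℓ} (M : CommutativeMonoid c ℓ) where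

  open CommutativeMonoid M renaming (refl to ≈-refl; sym to ≈-sym; trans to ≈-trans)
  open CommutativeSemigroupProperties commutativeSemigroup using (interchange)
  open import Relation.Binary.Reasoning.Setoid setoid

  fold : List A → (A → Carrier) → Carrier
  fold xs f = foldr (λ x s → f x ∙ s) ε xs

  -- In a sum `ε` is 0 and this is `x` times an indicator; in a product `ε` is 1 and the factor `x`
  -- is either present or absent.
  when : ∀ {P : Set p} → Dec P → Carrier → Carrier
  when P? x = if does P? then x else ε

  when-yes : ∀ {P : Set p} (P? : Dec P) {x} → P → when P? x ≈ x
  when-yes P? Px rewrite dec-true P? Px = ≈-refl

  when-no : ∀ {P : Set p} (P? : Dec P) {x} → ¬ P → when P? x ≈ ε
  when-no P? ¬Px rewrite dec-false P? ¬Px = ≈-refl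

  when-⇔ : ∀ {p q} {P : Set p} {Q : Set q} → P ⇔ Q →
           (P? : Dec P) (Q? : Dec Q) → ∀ x → when P? x ≈ when Q? x
  when-⇔ P⇔Q P? Q? x rewrite does-⇔ P⇔Q P? Q? = ≈-refl

  when-× : ∀ {p q} {P : Set p} {Q : Set q} (P? : Dec P) (Q? : Dec Q) x →
           when P? (when Q? x) ≈ when (P? ×-dec Q?) x
  when-× (yes _) Q? x = ≈-refl
  when-× (no _)  Q? x = ≈-refl

  when-cong : ∀ {P : Set p} (P? : Dec P) {x y} → x ≈ y → when P? x ≈ when P? y
  when-cong (yes _) x≈y = x≈y
  when-cong (no _)  x≈y = ≈-refl

  fold-cong-∈ : ∀ (xs : List A) {f g} → (∀ {x} → x ∈ˡ xs → f x ≈ g x) →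
                fold xs f ≈ fold xs g
  fold-cong-∈ []       f≈g = ≈-refl
  fold-cong-∈ (x ∷ xs) f≈g =
    ∙-cong (f≈g (here refl)) (fold-cong-∈ xs (f≈g ∘ there))

  fold-cong : ∀ (xs : List A) {f g} → (∀ x → f x ≈ g x) → fold xs f ≈ fold xs g
  fold-cong xs f≈g = fold-cong-∈ xs (λ {x} _ → f≈g x)

  fold-ε : ∀ (xs : List A) {f} → (∀ {x} → x ∈ˡ xs → f x ≈ ε) → fold xs f ≈ ε
  fold-ε []       f≈ε = ≈-refl
  fold-ε (x ∷ xs) f≈ε =
    ≈-trans (∙-cong (f≈ε (here refl)) (fold-ε xs (f≈ε ∘ there))) (identityˡ ε)

  fold-∙ : ∀ (xs : List A) f g →
           fold xs (λ x → f x ∙ g x) ≈ fold xs f ∙ fold xs g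
  fold-∙ []       f g = ≈-sym (identityˡ ε)
  fold-∙ (x ∷ xs) f g =
    ≈-trans (∙-congˡ (fold-∙ xs f g)) (interchange (f x) (g x) _ _)

  fold-swap : ∀ (xs : List A) (ys : List B) (f : A → B → Carrier) →
              fold xs (λ x → fold ys (f x)) ≈ fold ys (λ y → fold xs (λ x → f x y))
  fold-swap []       ys f = ≈-sym (fold-ε ys (λ _ → ≈-refl))
  fold-swap (x ∷ xs) ys f =
    ≈-trans (∙-congˡ (fold-swap xs ys f)) (≈-sym (fold-∙ ys (f x) _))

  fold-single : ∀ {xs : List A} {x f} → Unique xs → x ∈ˡ xs →
                (∀ {y} → y ∈ˡ xs → y ≢ x → f y ≈ ε) → fold xs f ≈ f x
  fold-single {xs = x ∷ xs} (x∉xs ∷ _) (here refl) f≈ε =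
    ≈-trans (∙-congˡ (fold-ε xs λ y∈ → f≈ε (there y∈) (All.lookup x∉xs y∈ ∘ sym)))
            (identityʳ _)
  fold-single {xs = x ∷ xs} (x∉xs ∷ xs!) (there z∈xs) f≈ε =
    ≈-trans (∙-cong (f≈ε (here refl) (All.lookup x∉xs z∈xs))
                    (fold-single xs! z∈xs (f≈ε ∘ there)))
            (identityˡ _)

  fold-++ : ∀ (xs ys : List A) f → fold (xs ++ ys) f ≈ fold xs f ∙ fold ys f
  fold-++ []       ys f = ≈-sym (identityˡ _)
  fold-++ (x ∷ xs) ys f = ≈-trans (∙-congˡ (fold-++ xs ys f)) (≈-sym (assoc _ _ _))

  fold-map : ∀ (h : A → B) xs f → fold (map h xs) f ≡ fold xs (f ∘ h)
  fold-map h []       f = refl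
  fold-map h (x ∷ xs) f = cong (f (h x) ∙_) (fold-map h xs f)

  fold-cartesianProductWith :
    ∀ {c} {C : Set c} (h : A → B → C) xs ys f →
    fold (cartesianProductWith h xs ys) f ≈ fold xs λ x → fold ys λ y → f (h x y)
  fold-cartesianProductWith h []       ys f = ≈-refl
  fold-cartesianProductWith h (x ∷ xs) ys f = begin
    fold (map (h x) ys ++ cartesianProductWith h xs ys) f
      ≈⟨ fold-++ (map (h x) ys) _ f ⟩
    fold (map (h x) ys) f ∙ fold (cartesianProductWith h xs ys) f
      ≈⟨ ∙-cong (reflexive (fold-map (h x) ys f)) (fold-cartesianProductWith h xs ys f) ⟩
    fold ys (λ y → f (h x y)) ∙ fold xs (λ x → fold ys λ y → f (h x y)) ∎

  fold-mapMaybe : ∀ (h : A → Maybe B) xs f →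
                  fold (mapMaybe h xs) f ≈ fold xs (maybe′ f ε ∘ h)
  fold-mapMaybe h []       f = ≈-refl
  fold-mapMaybe h (x ∷ xs) f with h x
  ... | just y  = ∙-congˡ (fold-mapMaybe h xs f)
  ... | nothing = ≈-trans (fold-mapMaybe h xs f) (≈-sym (identityˡ _))

  fold-filter : ∀ {P : Pred A p} (P? : Decidable P) xs f →
                fold (filter P? xs) f ≈ fold xs (λ x → when (P? x) (f x))
  fold-filter P? []       f = ≈-refl
  fold-filter P? (x ∷ xs) f with P? x
  ... | yes _ = ∙-congˡ (fold-filter P? xs f)
  ... | no  _ = ≈-trans (fold-filter P? xs f) (≈-sym (identityˡ _))

  fold-tabulate : ∀ {n} (h : Fin n → A) f →
                  fold (List.tabulate h) f ≡ fold (allFin n) (f ∘ h)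
  fold-tabulate h f = go h id
    where
    -- The tail of a tabulation shifts the index by `suc`, so the induction has to run over an
    -- arbitrary index map `k` and not just over `id`.
    go : ∀ {a b} {A : Set a} {B : Set b} {n} {f : B → Carrier} (h : A → B) (k : Fin n → A) →
         fold (List.tabulate (h ∘ k)) f ≡ fold (List.tabulate k) (f ∘ h)
    go {n = zero}          h k = refl
    go {n = suc n} {f = f} h k = cong (f (h (k zero)) ∙_) (go h (k ∘ suc))

  fold-allFin-suc : ∀ {n} f →
                    fold (allFin (suc n)) f ≡ f zero ∙ fold (allFin n) (f ∘ suc)
  fold-allFin-suc f = cong (f zero ∙_) (fold-tabulate suc f)

-- Extremal elements of decidable sets of points.

least : ∀ {p} {P : Pred (Fin n) p} → Decidable P → ∃ P →
        ∃ λ i → P i × (∀ j → P j → i Fin.≤ j)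
least {n = suc n} {P = P} P? (i , Pi) with P? zero | i
... | yes P0 | _     = zero , P0 , λ _ _ → z≤n
... | no ¬P0 | zero  = contradiction Pi ¬P0
... | no ¬P0 | suc k with j , Pj , j≤ ← least (P? ∘ suc) (k , Pi) =
  suc j , Pj , λ { zero P0 → contradiction P0 ¬P0 ; (suc l) Pl → s≤s (j≤ l Pl) }

greatest : ∀ {p} {P : Pred (Fin n) p} → Decidable P → ∃ P →
           ∃ λ i → P i × (∀ j → P j → j Fin.≤ i)
greatest {n = suc n} {P = P} P? (i , Pi) with Fin.any? (P? ∘ suc) | i
... | no ¬∃ | suc k = contradiction (k , Pi) ¬∃
... | no ¬∃ | zero  =
  zero , Pi , λ { zero _ → z≤n ; (suc j) Pj → contradiction (j , Pj) ¬∃ }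
... | yes ∃P | _ with j , Pj , ≤j ← greatest (P? ∘ suc) ∃P =
  suc j , Pj , λ { zero _ → z≤n ; (suc k) Pk → s≤s (≤j k Pk) }

-- Non-crossing partitions as equivalence relations.

infix 4 _~[_]_

_~[_]_ : Fin n → NC n → Fin n → Set
i ~[ π ] j = j ∈ block π i

_~[_]?_ : ∀ i (π : NC n) j → Dec (i ~[ π ] j)
i ~[ π ]? j = j ∈? block π i

module _ (π : NC n) where

  abstract

    ~-refl : ∀ {i} → i ~[ π ] i
    ~-refl {i} = proj₁ (proj₁ (NC-isNC π)) i

    ~⇒≡ : ∀ {i j} → i ~[ π ] j → block π j ≡ block π i
    ~⇒≡ = proj₂ (proj₁ (NC-isNC π)) _ _

    ~-sym : ∀ {i j} → i ~[ π ] j → j ~[ π ] i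
    ~-sym {i} p = subst (i ∈_) (sym (~⇒≡ p)) ~-refl

    ~-trans : ∀ {i j k} → i ~[ π ] j → j ~[ π ] k → i ~[ π ] k
    ~-trans {k = k} p q = subst (k ∈_) (~⇒≡ p) q

    ≡⇒~ : ∀ {i j} → block π i ≡ block π j → i ~[ π ] j
    ≡⇒~ {j = j} e = subst (j ∈_) (sym e) ~-refl

    ~-nonCrossing : ∀ {i j k l} → i Fin.< j → j Fin.< k → k Fin.< l →
                    i ~[ π ] k → j ~[ π ] l → i ~[ π ] j
    ~-nonCrossing i<j j<k k<l p q = ≡⇒~ (proj₂ (NC-isNC π) _ _ _ _ i<j j<k k<l p q)

    ∈-blocks⁺ : ∀ i → block π i ∈ˡ blocks π
    ∈-blocks⁺ i = ∈-deduplicate⁺ _≟ˢ_ (∈-toList⁺ (∈-lookup i (classes π)))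

    ∈-blocks⁻ : ∀ {W} → W ∈ˡ blocks π → ∃ λ i → W ≡ block π i
    ∈-blocks⁻ W∈ = _ , VecAny.lookup-index
      (∈-toList⁻ (∈-deduplicate⁻ _≟ˢ_ (toList (classes π)) W∈))

≤⇒~ : ∀ (π σ : NC n) → π ≤ σ → ∀ {i j} → i ~[ π ] j → i ~[ σ ] j
≤⇒~ π σ π≤σ {i} = All.lookup π≤σ (∈-blocks⁺ σ i) i (~-refl σ)

~⇒≤ : ∀ (π σ : NC n) → (∀ {i j} → i ~[ π ] j → i ~[ σ ] j) → π ≤ σ
~⇒≤ π σ f = All.tabulate λ W∈ i i∈W → aux (∈-blocks⁻ σ W∈) i∈W
  where
  aux : ∀ {W i} → (∃ λ k → W ≡ block σ k) → i ∈ W → block π i ⊆ W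
  aux (k , refl) k~i i~j = ~-trans σ k~i (f i~j)

≤-refl : (π : NC n) → π ≤ π
≤-refl π = ~⇒≤ π π id

≤-trans : (π ρ σ : NC n) → π ≤ ρ → ρ ≤ σ → π ≤ σ
≤-trans π ρ σ π≤ρ ρ≤σ = ~⇒≤ π σ (≤⇒~ ρ σ ρ≤σ ∘ ≤⇒~ π ρ π≤ρ)

classes-injective : ∀ {π ρ : NC n} → classes π ≡ classes ρ → π ≡ ρ
classes-injective {π = mkNC _ _} {mkNC _ _} refl = refl

NC-ext : ∀ {π ρ : NC n} → (∀ {i j} → i ~[ π ] j → i ~[ ρ ] j) →
         (∀ {i j} → i ~[ ρ ] j → i ~[ π ] j) → π ≡ ρ
NC-ext {π = π} {ρ} f g = classes-injective (trans (sym (tabulate∘lookup (classes π)))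
  (trans (tabulate-cong λ i → ⊆-antisym f g) (tabulate∘lookup (classes ρ))))

∈-tabulate⁺ : ∀ {p} {P : Pred (Fin n) p} (P? : Decidable P) {i} →
              P i → i ∈ tabulate (does ∘ P?)
∈-tabulate⁺ P? {i} Pi =
  lookup⇒[]= i _ (trans (lookup∘tabulate _ i) (dec-true (P? i) Pi))

∈-tabulate⁻ : ∀ {p} {P : Pred (Fin n) p} (P? : Decidable P) {i} →
              i ∈ tabulate (does ∘ P?) → P i
∈-tabulate⁻ P? {i} i∈ with P? i | trans (sym (lookup∘tabulate (does ∘ P?) i)) ([]=⇒lookup i∈)
... | yes Pi | _ = Pi
... | no  _  | ()

module FromRelation
  {R : Fin n → Fin n → Set} (R? : ∀ i j → Dec (R i j))
  (R-refl : ∀ {i} → R i i) (R-sym : ∀ {i j} → R i j → R j i)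
  (R-trans : ∀ {i j k} → R i j → R j k → R i k)
  (R-nonCrossing : ∀ {i j k l} → i Fin.< j → j Fin.< k → k Fin.< l →
                   R i k → R j l → R i j)
  where

  private
    family : Vec (Subset n) n
    family = tabulate λ i → tabulate (does ∘ R? i)

    to : ∀ {i j} → j ∈ lookup family i → R i j
    to {i} {j} p = ∈-tabulate⁻ (R? i) (subst (j ∈_) (lookup∘tabulate _ i) p)

    from : ∀ {i j} → R i j → j ∈ lookup family i
    from {i} {j} p = subst (j ∈_) (sym (lookup∘tabulate _ i)) (∈-tabulate⁺ (R? i) p)

    same : ∀ {i j} → R i j → lookup family j ≡ lookup family i
    same Rij = ⊆-antisym (λ p → from (R-trans Rij (to p)))
                         (λ p → from (R-trans (R-sym Rij) (to p)))

  partition : NC n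
  partition = mkNC family
    ( ((λ i → from R-refl) , λ i j p → same (to p))
    , λ i j k l i<j j<k k<l p q → sym (same (R-nonCrossing i<j j<k k<l (to p) (to q))))

  partition⁻ : ∀ {i j} → i ~[ partition ] j → R i j
  partition⁻ = to

  partition⁺ : ∀ {i j} → R i j → i ~[ partition ] j
  partition⁺ = from

-- Minima and convex hulls of blocks.

Min : NC n → Fin n → Set
Min π i = ∀ j → i ~[ π ] j → i Fin.≤ j

abstract
  min? : ∀ (π : NC n) i → Dec (Min π i)
  min? π i = Fin.all? λ j → (i ~[ π ]? j) →-dec (i Fin.≤? j)

minOf : ∀ (π : NC n) i → ∃ λ a → Min π a × a ~[ π ] i × a Fin.≤ i
minOf π i with a , i~a , a≤ ← least (i ~[ π ]?_) (i , ~-refl π) =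
  a , (λ j a~j → a≤ j (~-trans π i~a a~j)) , ~-sym π i~a , a≤ i (~-refl π)

Min-unique : ∀ (π : NC n) {i j} → Min π i → Min π j → i ~[ π ] j → i ≡ j
Min-unique π mi mj i~j = Fin.≤-antisym (mi _ i~j) (mj _ (~-sym π i~j))

Min-≤ : ∀ (π ρ : NC n) → π ≤ ρ → ∀ {i} → Min ρ i → Min π i
Min-≤ π ρ π≤ρ mi j i~j = mi j (≤⇒~ π ρ π≤ρ i~j)

-- The interval from `b` to the maximum of its block, hence the convex hull of the block when `b` is
-- its minimum. Any point `d` of the block at or beyond `i` is a witness, so the maximum need not be
-- named.
Hull : NC n → Fin n → Fin n → Set
Hull π b i = b Fin.≤ i × ∃ λ d → i Fin.≤ d × b ~[ π ] d

abstract
  hull? : ∀ (π : NC n) b i → Dec (Hull π b i)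
  hull? π b i = (b Fin.≤? i) ×-dec Fin.any? λ d → (i Fin.≤? d) ×-dec (b ~[ π ]? d)

Hull-convex : ∀ (π : NC n) {b i j k} → i Fin.≤ j → j Fin.≤ k →
              Hull π b i → Hull π b k → Hull π b j
Hull-convex π i≤j j≤k (b≤i , _) (_ , d , k≤d , b~d) =
  ℕ.≤-trans b≤i i≤j , d , ℕ.≤-trans j≤k k≤d , b~d

~⇒Hull : ∀ (π : NC n) {b i} → Min π b → b ~[ π ] i → Hull π b i
~⇒Hull π {i = i} mb b~i = mb i b~i , i , ℕ.≤-refl , b~i

Hull-cases : ∀ (π : NC n) {b i} → Hull π b i →
             b ~[ π ] i ⊎ (b Fin.< i × ∃ λ d → i Fin.< d × b ~[ π ] d)
Hull-cases π {b} {i} (b≤i , d , i≤d , b~d) with b Fin.≟ i | i Fin.≟ d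
... | yes refl | _        = inj₁ (~-refl π)
... | _        | yes refl = inj₁ b~d
... | no b≢i   | no i≢d   =
  inj₂ (Fin.≤∧≢⇒< b≤i b≢i , d , Fin.≤∧≢⇒< i≤d i≢d , b~d)

-- A block that meets the hull cannot leave it. If `i` lies strictly between `b` and `d` while `j`
-- lies before `b` or after `d`, then the two blocks cross unless they coincide, and then `j` is in
-- the block of `b` after all.
Hull-resp : ∀ (π : NC n) {b i j} → Min π b → Hull π b i → i ~[ π ] j → Hull π b j
Hull-resp π {b} {i} {j} mb h i~j with Hull-cases π h
... | inj₁ b~i = ~⇒Hull π mb (~-trans π b~i i~j)
... | inj₂ (b<i , d , i<d , b~d) with j Fin.<? b | j Fin.≤? d
...   | yes j<b | _       = ~⇒Hull π mb (~-sym π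
          (~-nonCrossing π j<b b<i i<d (~-sym π i~j) b~d))
...   | no j≮b  | yes j≤d = ℕ.≮⇒≥ j≮b , d , j≤d , b~d
...   | no _    | no j≰d  = ~⇒Hull π mb (~-trans π
          (~-nonCrossing π b<i i<d (ℕ.≰⇒> j≰d) b~d i~j) i~j)

-- The order of Belinschi and Nica: π ≤ ρ and, in each block of ρ, the
-- minimum and the maximum lie in the same block of π. Only the second
-- condition is recorded, with the block of ρ covered by a hull of π.

infix 4 _≪_

_≪_ : NC n → NC n → Set
π ≪ ρ = ∀ i j → Min ρ i → i ~[ ρ ] j → Hull π i j

abstract
  _≪?_ : (π ρ : NC n) → Dec (π ≪ ρ)
  π ≪? ρ = Fin.all? λ i → Fin.all? λ j →
    min? ρ i →-dec (i ~[ ρ ]? j) →-dec hull? π i j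

-- Points a < d of a block of π around i, in the same block of σ as i, force
-- the whole block of π through i to lie strictly inside it, by
-- non-crossingness: i is the minimum of a block that becomes inner after
-- restriction to its block of σ.

InnerMin : NC n → NC n → Fin n → Set
InnerMin π σ i = Min π i × ∃₂ λ a d → a Fin.< i × i Fin.< d × a ~[ π ] d × a ~[ σ ] i

abstract
  innerMin? : ∀ (π σ : NC n) i → Dec (InnerMin π σ i)
  innerMin? π σ i = min? π i ×-dec Fin.any? λ a → Fin.any? λ d →
    (a Fin.<? i) ×-dec (i Fin.<? d) ×-dec (a ~[ π ]? d) ×-dec (a ~[ σ ]? i)

-- Merging inner blocks into surrounding ones.

Merged : NC n → NC n → Fin n → Set
Merged π ρ i = Min π i × ¬ Min ρ i

abstract
  merged? : ∀ (π ρ : NC n) i → Dec (Merged π ρ i)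
  merged? π ρ i = min? π i ×-dec ¬? (min? ρ i)

-- These are the ρ that can contribute to the convolution of `quotient u` with `gₜ` at the pair (π,
-- σ); all other terms vanish.
record Merges (π σ ρ : NC n) : Set where
  constructor mkMerges
  field
    π≤ρ : π ≤ ρ
    ρ≤σ : ρ ≤ σ
    π≪ρ : π ≪ ρ

abstract
  merges? : ∀ (π σ ρ : NC n) → Dec (Merges π σ ρ)
  merges? π σ ρ = map′ (λ (p , q , r) → mkMerges p q r)
                       (λ m → let open Merges m in π≤ρ , ρ≤σ , π≪ρ)
                       ((π ≤? ρ) ×-dec (ρ ≤? σ) ×-dec (π ≪? ρ))

module _ (π σ ρ : NC n) (m : Merges π σ ρ) where

  open Merges m

  -- The π-hull of the minimum `a` of the ρ-block of `i` contains `i`. If `i` were in the π-block of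
  -- `a`, the two minima would agree and `i` would be a minimum of ρ. So the π-block of `a` passes
  -- around `i`.
  Merged⇒InnerMin : ∀ {i} → Merged π ρ i → InnerMin π σ i
  Merged⇒InnerMin {i} (mi , ¬mi) with a , ma , a~i , a≤i ← minOf ρ i
    with Hull-cases π (π≪ρ a i ma a~i)
  ... | inj₁ a~′i = contradiction (subst (Min ρ) (Min-unique π (Min-≤ π ρ π≤ρ ma) mi a~′i) ma) ¬mi
  ... | inj₂ (a<i , d , i<d , a~d) = mi , a , d , a<i , i<d , a~d , ≤⇒~ ρ σ ρ≤σ a~i

  InnerMin-↑ : ∀ {i} → Min ρ i → InnerMin π σ i → InnerMin ρ σ i
  InnerMin-↑ mi (_ , a , d , a<i , i<d , a~d , a~i) =
    mi , a , d , a<i , i<d , ≤⇒~ π ρ π≤ρ a~d , a~i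

  -- A pair around `i` in one ρ-block can be widened to one in a single π-block: move `a` down to
  -- the minimum of its ρ-block, and use `π≪ρ` to find a point of the π-block of that minimum at or
  -- beyond `d`.
  InnerMin-↓ : ∀ {i} → InnerMin ρ σ i → InnerMin π σ i
  InnerMin-↓ {i} (mi , a , d , a<i , i<d , a~d , a~i) with a′ , ma′ , a′~a , a′≤a ← minOf ρ a
    with _ , d′ , d≤d′ , a′~d′ ← π≪ρ a′ d ma′ (~-trans ρ a′~a a~d) =
    Min-≤ π ρ π≤ρ mi , a′ , d′ , ℕ.≤-<-trans a′≤a a<i , ℕ.<-≤-trans i<d d≤d′ , a′~d′ ,
    ~-trans σ (≤⇒~ ρ σ ρ≤σ a′~a) a~i

  -- With `Hull-≤` this identifies the hulls of π and ρ that start at a minimum of ρ: the π-block of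
  -- that minimum already reaches as far right as its ρ-block.
  ≪-Hull : ∀ {b i} → Min ρ b → Hull ρ b i → Hull π b i
  ≪-Hull mb (b≤i , d , i≤d , b~d) with _ , d′ , d≤d′ , b~d′ ← π≪ρ _ d mb b~d =
    b≤i , d′ , ℕ.≤-trans i≤d d≤d′ , b~d′

  Hull-≤ : ∀ {b i} → Hull π b i → Hull ρ b i
  Hull-≤ (b≤i , d , i≤d , b~d) = b≤i , d , i≤d , ≤⇒~ π ρ π≤ρ b~d

  -- Points lie in the same block of ρ iff they lie in the same π-hulls of
  -- blocks whose minimum is not merged.

  ~⇒sameHulls : ∀ {i j b} → i ~[ ρ ] j → Min ρ b → Hull π b i → Hull π b j
  ~⇒sameHulls i~j mb h = ≪-Hull mb (Hull-resp ρ mb (Hull-≤ h) i~j)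

  sameHulls⇒~ : ∀ {i j} → (∀ {b} → Min ρ b → Hull π b i → Hull π b j) →
                (∀ {b} → Min ρ b → Hull π b j → Hull π b i) → i ~[ ρ ] j
  sameHulls⇒~ {i} {j} f g with minOf ρ i | minOf ρ j
  ... | b , mb , b~i , _ | c , mc , c~j , _ =
    ~-trans ρ (~-sym ρ b~i) (subst (_~[ ρ ] j) (sym b≡c) c~j)
    where
    bj : Hull π b j
    bj = f mb (π≪ρ b i mb b~i)
    ci : Hull π c i
    ci = g mc (π≪ρ c j mc c~j)
    -- the minimum of the block of c, resp. b, lies in the hull of the other
    b≡c : b ≡ c
    b≡c = Fin.≤-antisym (proj₁ (Hull-resp ρ mb (Hull-≤ bj) (~-sym ρ c~j)))
                        (proj₁ (Hull-resp ρ mc (Hull-≤ ci) (~-sym ρ b~i)))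

-- The description of ρ by hulls involves only π and the set of minima of ρ, so these minima
-- determine ρ.
merges-unique : ∀ (π σ ρ ρ′ : NC n) → Merges π σ ρ → Merges π σ ρ′ →
                (∀ {i} → Min ρ i → Min ρ′ i) → (∀ {i} → Min ρ′ i → Min ρ i) → ρ ≡ ρ′
merges-unique π σ ρ ρ′ m m′ f g = NC-ext (half ρ ρ′ m m′ g) (half ρ′ ρ m′ m f)
  where
  half : ∀ ρ ρ′ → Merges π σ ρ → Merges π σ ρ′ → (∀ {i} → Min ρ′ i → Min ρ i) →
         ∀ {i j} → i ~[ ρ ] j → i ~[ ρ′ ] j
  half ρ ρ′ m m′ g i~j = sameHulls⇒~ π σ ρ′ m′
    (λ mb → ~⇒sameHulls π σ ρ m i~j (g mb))
    (λ mb → ~⇒sameHulls π σ ρ m (~-sym ρ i~j) (g mb))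

-- The inverse of ρ ↦ {merged minima}: two points of a block of σ are joined
-- iff they lie in the same hulls of blocks whose minimum is not in A.

module Merge (π σ : NC n) (π≤σ : π ≤ σ)
             (A : Subset n) (A⊆I : ∀ {i} → i ∈ A → InnerMin π σ i) where

  Kept : Fin n → Set
  Kept b = Min π b × ¬ b ∈ A

  kept? : ∀ b → Dec (Kept b)
  kept? b = min? π b ×-dec ¬? (b ∈? A)

  -- Restricting to hulls that start in the σ-block of `i` makes every such `b` a candidate for the
  -- minimum of the merged block of `i`.
  KeptHull : Fin n → Fin n → Set
  KeptHull i b = Kept b × b ~[ σ ] i × Hull π b i

  keptHull? : ∀ i b → Dec (KeptHull i b)
  keptHull? i b = kept? b ×-dec (b ~[ σ ]? i) ×-dec hull? π b i

  SameHulls : Fin n → Fin n → Set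
  SameHulls i j = i ~[ σ ] j ×
    (∀ b → KeptHull i b → Hull π b j) × (∀ b → KeptHull j b → Hull π b i)

  private
    move : ∀ {i j b} → SameHulls i j → KeptHull i b → KeptHull j b
    move (i~j , f , _) h@(k , b~i , _) = k , ~-trans σ b~i i~j , f _ h

    S-sym : ∀ {i j} → SameHulls i j → SameHulls j i
    S-sym (i~j , f , g) = ~-sym σ i~j , g , f

    S-trans : ∀ {i j k} → SameHulls i j → SameHulls j k → SameHulls i k
    S-trans s@(i~j , f , g) t@(j~k , f′ , g′) =
      ~-trans σ i~j j~k , (λ b → f′ b ∘ move s) , (λ b → g b ∘ move (S-sym t))

    -- Hulls are intervals. One that contains `i` contains `k`, hence also `j`; one that contains
    -- `j` contains `l`, hence `k`, hence `i`. That `i` and `j` share a σ-block is the non-crossing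
    -- property of σ.
    S-nonCrossing : ∀ {i j k l} → i Fin.< j → j Fin.< k → k Fin.< l →
                    SameHulls i k → SameHulls j l → SameHulls i j
    S-nonCrossing i<j j<k k<l s@(i~k , f , g) t@(j~l , f′ , g′) =
      i~j ,
      (λ b h → Hull-convex π (ℕ.<⇒≤ i<j) (ℕ.<⇒≤ j<k) (proj₂ (proj₂ h)) (f b h)) ,
      (λ b h → proj₂ (proj₂ (move (S-sym s) (proj₁ h , ~-trans σ (proj₁ (proj₂ h)) j~k ,
        Hull-convex π (ℕ.<⇒≤ j<k) (ℕ.<⇒≤ k<l) (proj₂ (proj₂ h)) (f′ b h)))))
      where
      i~j = ~-nonCrossing σ i<j j<k k<l i~k j~l
      j~k = ~-trans σ (~-sym σ i~j) i~k

    sameHulls? : ∀ i j → Dec (SameHulls i j)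
    sameHulls? i j = (i ~[ σ ]? j) ×-dec
      Fin.all? (λ b → keptHull? i b →-dec hull? π b j) ×-dec
      Fin.all? (λ b → keptHull? j b →-dec hull? π b i)

    module Glued = FromRelation sameHulls?
      (λ {i} → ~-refl σ , (λ b h → proj₂ (proj₂ h)) , (λ b h → proj₂ (proj₂ h)))
      S-sym S-trans S-nonCrossing

  abstract
    merge : NC n
    merge = Glued.partition

    merge⁺ : ∀ {i j} → SameHulls i j → i ~[ merge ] j
    merge⁺ = Glued.partition⁺

    merge⁻ : ∀ {i j} → i ~[ merge ] j → SameHulls i j
    merge⁻ = Glued.partition⁻

    -- An outermost hull around i within the block of σ through i has a
    -- minimum that is not inner, hence kept.
    outermost : ∀ i → ∃ (KeptHull i)
    outermost i with
      least (λ b → min? π b ×-dec (b ~[ σ ]? i) ×-dec hull? π b i)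
            (let a , ma , a~i , _ = minOf π i in a , ma , ≤⇒~ π σ π≤σ a~i , ~⇒Hull π ma a~i)
    ... | b , (mb , b~i , h) , b≤ = b , (mb , b∉A) , b~i , h
      where
      b∉A : ¬ b ∈ A
      b∉A b∈A with A⊆I b∈A
      ... | _ , a , d , a<b , b<d , a~d , a~b with minOf π a
      ...   | a′ , ma′ , a′~a , a′≤a = ℕ.<⇒≱ (ℕ.≤-<-trans a′≤a a<b)
        (b≤ a′ (ma′ , ~-trans σ (≤⇒~ π σ π≤σ a′~a) (~-trans σ a~b b~i) , hull))
        where
        a′<b : a′ Fin.< b
        a′<b = ℕ.≤-<-trans a′≤a a<b
        hb : Hull π a′ b
        hb = ℕ.<⇒≤ a′<b , d , ℕ.<⇒≤ b<d , ~-trans π a′~a a~d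
        hull : Hull π a′ i
        hull with e , i≤e , b~e ← proj₂ h =
          Hull-convex π (proj₁ h) i≤e hb (Hull-resp π ma′ hb b~e)

  -- Let `b` be the greatest start of a kept hull around `i`. A kept hull that contains `b` contains
  -- the whole π-block of `b`, which reaches to `i` or beyond, so it contains `i`. Conversely a kept
  -- hull around `i` starts at or before `b`, so it contains `b`. Thus `b` and `i` are joined, and
  -- each merged block is covered by the hull of a kept minimum in it.
  innermost : ∀ i → ∃ λ b → Kept b × b ~[ merge ] i × (∀ {j} → i ~[ merge ] j → Hull π b j)
  innermost i = covering (greatest (keptHull? i) (outermost i))
    where
    covering : (∃ λ b → KeptHull i b × (∀ c → KeptHull i c → c Fin.≤ b)) →
               ∃ λ b → Kept b × b ~[ merge ] i × (∀ {j} → i ~[ merge ] j → Hull π b j)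
    covering (b , (k , b~i , h@(b≤i , e , i≤e , b~e)) , ≤b) =
      b , k , merge⁺ (b~i , above , below) ,
      λ i~j → proj₁ (proj₂ (merge⁻ i~j)) b (k , b~i , h)
      where
      above : ∀ c → KeptHull b c → Hull π c i
      above c ((mc , _) , c~b , hc) = Hull-convex π b≤i i≤e hc (Hull-resp π mc hc b~e)
      below : ∀ c → KeptHull i c → Hull π c b
      below c hc@(_ , _ , _ , e , i≤e , c~e) = ≤b c hc , e , ℕ.≤-trans b≤i i≤e , c~e

  -- By `Hull-resp`, two points of one π-block lie in the same hulls.
  π≤merge : π ≤ merge
  π≤merge = ~⇒≤ π merge λ i~j → merge⁺ (≤⇒~ π σ π≤σ i~j ,
    (λ b h → Hull-resp π (proj₁ (proj₁ h)) (proj₂ (proj₂ h)) i~j) ,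
    (λ b h → Hull-resp π (proj₁ (proj₁ h)) (proj₂ (proj₂ h)) (~-sym π i~j)))

  merge≤σ : merge ≤ σ
  merge≤σ = ~⇒≤ merge σ λ i~j → proj₁ (merge⁻ i~j)

  -- The hull that starts at `i` is itself one of the kept hulls around `i`, so no point joined to
  -- `i` lies before it.
  Kept⇒Min : ∀ {i} → Kept i → Min merge i
  Kept⇒Min {i} k@(mi , _) j i~j =
    proj₁ (proj₁ (proj₂ (merge⁻ i~j)) i (k , ~-refl σ , ~⇒Hull π mi (~-refl π)))

  Min⇒Kept : ∀ {i} → Min merge i → Kept i
  Min⇒Kept {i} mi =
    let b , k , b~i , _ = innermost i in
    subst Kept (Min-unique merge (Kept⇒Min k) mi b~i) k

  π≪merge : π ≪ merge
  π≪merge i j mi i~j =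
    let b , k , b~i , cover = innermost i in
    subst (λ x → Hull π x j) (Min-unique merge (Kept⇒Min k) mi b~i) (cover i~j)

  merges : Merges π σ merge
  merges = mkMerges π≤merge merge≤σ π≪merge

  Merged⇒∈ : ∀ {i} → Merged π merge i → i ∈ A
  Merged⇒∈ {i} (mi , ¬mi) with i ∈? A
  ... | yes i∈A = i∈A
  ... | no  i∉A = contradiction (Kept⇒Min (mi , i∉A)) ¬mi

  ∈⇒Merged : ∀ {i} → i ∈ A → Merged π merge i
  ∈⇒Merged i∈A = proj₁ (A⊆I i∈A) , λ mi → proj₂ (Min⇒Kept mi) i∈A

-- Inner blocks and restriction to the blocks of σ.

maxOf : ∀ (π : NC n) i → ∃ λ c → i ~[ π ] c × (∀ k → i ~[ π ] k → k Fin.≤ c)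
maxOf π i = greatest (i ~[ π ]?_) (i , ~-refl π)

Straddled : NC n → Fin n → Set
Straddled π i = ∃₂ λ a d → a Fin.< i × i Fin.< d × a ~[ π ] d

IsInner⇒Straddled : ∀ (π : NC n) i → IsInner π (block π i) → Straddled π i
IsInner⇒Straddled π i inner with find inner
... | W , W∈ , a , b , c , d ,
      ((a∈W , _) , (_ , b≤) , (_ , ≤c) , (d∈W , _)) , (a<b , b≤c , c<d)
  with k , refl ← ∈-blocks⁻ π W∈ =
  a , d , ℕ.<-≤-trans a<b (b≤ i (~-refl π)) , ℕ.≤-<-trans (≤c i (~-refl π)) c<d ,
  ~-trans π (~-sym π a∈W) d∈W

-- The block of `a` encloses that of `i`. They are different blocks, because `a` lies before the
-- minimum `i`; so the block of `i` can neither share the maximum of the other block nor, without a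
-- crossing, pass beyond it.
Straddled⇒IsInner : ∀ (π : NC n) {i} → Min π i → Straddled π i → IsInner π (block π i)
Straddled⇒IsInner π {i} mi (a , d , a<i , i<d , a~d)
  with minOf π a | maxOf π a | maxOf π i
... | a′ , ma′ , a′~a , a′≤a | d′ , a~d′ , ≤d′ | c , i~c , ≤c =
  lose (∈-blocks⁺ π a) (a′ , i , c , d′ ,
    ((~-sym π a′~a , λ k a~k → ma′ k (~-trans π a′~a a~k)) ,
     (~-refl π , mi) , (i~c , ≤c) , (a~d′ , ≤d′)) ,
    (ℕ.≤-<-trans a′≤a a<i , mi c i~c , c<d′))
  where
  a≁i : ¬ a ~[ π ] i
  a≁i a~i = ℕ.<⇒≱ a<i (mi a (~-sym π a~i))
  c<d′ : c Fin.< d′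
  c<d′ with Fin.<-cmp c d′
  ... | tri< c<d′ _ _ = c<d′
  ... | tri≈ _ refl _ = contradiction (~-trans π a~d′ (~-sym π i~c)) a≁i
  ... | tri> _ _ d′<c = contradiction
          (~-nonCrossing π a<i (ℕ.<-≤-trans i<d (≤d′ d a~d)) d′<c a~d′ i~c) a≁i

point-∈ : ∀ (W : Subset n) j → point W j ∈ W
point-∈ (inside  Vec.∷ W) zero    = Vec.here
point-∈ (inside  Vec.∷ W) (suc j) = Vec.there (point-∈ W j)
point-∈ (outside Vec.∷ W) j       = Vec.there (point-∈ W j)

point-surjective : ∀ (W : Subset n) {i} → i ∈ W → ∃ λ j → point W j ≡ i
point-surjective (inside  Vec.∷ W) Vec.here = zero , refl
point-surjective (inside  Vec.∷ W) (Vec.there i∈W) =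
  let j , eq = point-surjective W i∈W in suc j , cong suc eq
point-surjective (outside Vec.∷ W) (Vec.there i∈W) =
  let j , eq = point-surjective W i∈W in j , cong suc eq

point-mono-≤ : ∀ (W : Subset n) {i j} → i Fin.≤ j → point W i Fin.≤ point W j
point-mono-≤ W {i} {j} i≤j with i Fin.≟ j
... | yes refl = ℕ.≤-refl
... | no  i≢j  = ℕ.<⇒≤ (point-mono-< W (Fin.≤∧≢⇒< i≤j i≢j))

point-cancel-< : ∀ (W : Subset n) {i j} → point W i Fin.< point W j → i Fin.< j
point-cancel-< W p = ℕ.≰⇒> λ j≤i → ℕ.<⇒≱ p (point-mono-≤ W j≤i)

point-cancel-≤ : ∀ (W : Subset n) {i j} → point W i Fin.≤ point W j → i Fin.≤ j
point-cancel-≤ W p = ℕ.≮⇒≥ λ j<i → ℕ.<⇒≱ (point-mono-< W j<i) p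

module _ (π : NC n) (W : Subset n) where

  ↾-~⁻ : ∀ {i j} → i ~[ π ↾ W ] j → point W i ~[ π ] point W j
  ↾-~⁻ {i} {j} p = ∈-preimage⁻ (point W) _ (subst (j ∈_) (lookup∘tabulate _ i) p)

  ↾-~⁺ : ∀ {i j} → point W i ~[ π ] point W j → i ~[ π ↾ W ] j
  ↾-~⁺ {i} {j} p =
    subst (j ∈_) (sym (lookup∘tabulate _ i)) (∈-preimage⁺ (point W) _ p)

module _ (π σ : NC n) (π≤σ : π ≤ σ) (k : Fin n) where

  private
    W : Subset n
    W = block σ k

    pt : ∀ {i} → k ~[ σ ] i → ∃ λ j → point W j ≡ i
    pt = point-surjective W

  ↾-Min⁺ : ∀ {j} → Min π (point W j) → Min (π ↾ W) j
  ↾-Min⁺ m l j~l = point-cancel-≤ W (m _ (↾-~⁻ π W j~l))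

  -- Since π ≤ σ, the π-block of a point of `W` stays inside `W`, and restriction loses no smaller
  -- element of it.
  ↾-Min⁻ : ∀ {j} → Min (π ↾ W) j → Min π (point W j)
  ↾-Min⁻ {j} m i p~i with pt (~-trans σ (point-∈ W j) (≤⇒~ π σ π≤σ p~i))
  ... | l , refl = point-mono-≤ W (m l (↾-~⁺ π W p~i))

  -- This lets inner blocks of all the restrictions be counted on the points of π itself. The clause
  -- of `InnerMin` about σ says that the surrounding pair lies in `W`, so the pair can be pulled
  -- back along `point W`.
  ↾-InnerMin : ∀ j → (Min (π ↾ W) j × IsInner (π ↾ W) (block (π ↾ W) j)) ⇔
                     InnerMin π σ (point W j)
  ↾-InnerMin j = mk⇔ to from
    where
    to : Min (π ↾ W) j × IsInner (π ↾ W) (block (π ↾ W) j) → InnerMin π σ (point W j)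
    to (m , inner) with a , d , a<j , j<d , a~d ← IsInner⇒Straddled (π ↾ W) j inner =
      ↾-Min⁻ m , point W a , point W d , point-mono-< W a<j , point-mono-< W j<d ,
      ↾-~⁻ π W a~d , ~-trans σ (~-sym σ (point-∈ W a)) (point-∈ W j)

    from : InnerMin π σ (point W j) → Min (π ↾ W) j × IsInner (π ↾ W) (block (π ↾ W) j)
    from (m , a , d , a<j , j<d , a~d , a~j)
      with k~a ← ~-trans σ (point-∈ W j) (~-sym σ a~j)
      with pt k~a | pt (~-trans σ k~a (≤⇒~ π σ π≤σ a~d))
    ... | a′ , refl | d′ , refl = ↾-Min⁺ m , Straddled⇒IsInner (π ↾ W) (↾-Min⁺ m)
      (a′ , d′ , point-cancel-< W a<j , point-cancel-< W j<d , ↾-~⁺ π W a~d)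

-- Enumerations without repetition.

subsets : ∀ n → List (Subset n)
subsets = vectors (inside ∷ outside ∷ [])

module _ {a} {A : Set a} {xs : List A} where

  vectors-unique : Unique xs → ∀ n → Unique (vectors xs n)
  vectors-unique xs! zero    = [] ∷ []
  vectors-unique xs! (suc n) =
    cartesianProductWith⁺ Vec._∷_ ∷-injective xs! (vectors-unique xs! n)

  ∈-vectors : (∀ x → x ∈ˡ xs) → (v : Vec A n) → v ∈ˡ vectors xs n
  ∈-vectors ∈xs Vec.[]       = here refl
  ∈-vectors ∈xs (x Vec.∷ v) =
    ∈-cartesianProductWith⁺ Vec._∷_ (∈xs x) (∈-vectors ∈xs v)

subsets-unique : ∀ n → Unique (subsets n)
subsets-unique = vectors-unique (((λ ()) ∷ []) ∷ [] ∷ [])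

∈-subsets : (A : Subset n) → A ∈ˡ subsets n
∈-subsets = ∈-vectors λ { true → here refl ; false → there (here refl) }

blocks-unique : (π : NC n) → Unique (blocks π)
blocks-unique π = DecUnique.deduplicate-! _≟ˢ_ (toList (classes π))

-- Folds over partitions, blocks and points.

module FoldNC {c ℓ} (M : CommutativeMonoid c ℓ) where

  open CommutativeMonoid M renaming (refl to ≈-refl; sym to ≈-sym; trans to ≈-trans)
  open Fold M
  open import Relation.Binary.Reasoning.Setoid setoid

  -- The fold is transported to the list of all families of subsets, which has no repetitions. A
  -- family that is not a non-crossing partition contributes `ε`, and only the family of ρ remains.
  fold-allNC-single : ∀ (ρ : NC n) f → (∀ τ → τ ≢ ρ → f τ ≈ ε) →
                      fold (allNC n) f ≈ f ρ
  fold-allNC-single {n} ρ f f≈ε = begin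
    fold (allNC n) f                            ≈⟨ fold-mapMaybe _ (vectors (subsets n) n) f ⟩
    fold (vectors (subsets n) n) (λ b → at b (isNC? b))
      ≈⟨ fold-single (vectors-unique (subsets-unique n) n) (∈-vectors ∈-subsets (classes ρ))
           (λ {b} _ b≢ → away b (isNC? b) b≢) ⟩
    at (classes ρ) (isNC? (classes ρ))          ≈⟨ at-ρ (isNC? (classes ρ)) ⟩
    f ρ                                         ∎
    where
    at : ∀ b → Dec (IsNC b) → Carrier
    at b d = maybe′ f ε (toNC b d)
    at-ρ : ∀ d → at (classes ρ) d ≈ f ρ
    at-ρ (yes _) = ≈-refl
    at-ρ (no ¬p) = contradiction (NC-isNC ρ) ¬p
    away : ∀ b d → b ≢ classes ρ → at b d ≈ ε
    away b (yes p) b≢ = f≈ε (mkNC b p) (b≢ ∘ cong classes)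
    away b (no _)  b≢ = ≈-refl

  -- Double counting of the pairs of a block and its minimum: each block has exactly one minimum,
  -- and each minimum lies in exactly one block.
  fold-blocks : ∀ (π : NC n) F →
    fold (blocks π) F ≈ fold (allFin n) λ i → when (min? π i) (F (block π i))
  fold-blocks {n} π F = ≈-sym (begin
    fold (allFin n) (λ i → when (min? π i) (F (block π i)))
      ≈⟨ fold-cong (allFin n) (λ i → ≈-sym (inBlock i)) ⟩
    fold (allFin n) (λ i → fold (blocks π) λ V → when (atMin? i V) (F V))
      ≈⟨ fold-swap (allFin n) (blocks π) _ ⟩
    fold (blocks π) (λ V → fold (allFin n) λ i → when (atMin? i V) (F V))
      ≈⟨ fold-cong-∈ (blocks π) (λ V∈ → oneMin (∈-blocks⁻ π V∈)) ⟩
    fold (blocks π) F ∎)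
    where
    atMin? : ∀ i V → Dec (Min π i × V ≡ block π i)
    atMin? i V = min? π i ×-dec (V ≟ˢ block π i)
    inBlock : ∀ i → fold (blocks π) (λ V → when (atMin? i V) (F V)) ≈
                    when (min? π i) (F (block π i))
    inBlock i = ≈-trans
      (fold-single (blocks-unique π) (∈-blocks⁺ π i)
        λ {V} _ V≢ → when-no (atMin? i V) (V≢ ∘ proj₂))
      (when-⇔ (mk⇔ proj₁ (_, refl)) (atMin? i (block π i)) (min? π i) _)
    oneMin : ∀ {V} → (∃ λ k → V ≡ block π k) →
             fold (allFin n) (λ i → when (atMin? i V) (F V)) ≈ F V
    oneMin (k , refl) with a , ma , a~k , _ ← minOf π k = ≈-trans
      (fold-single (allFin⁺ n) (∈-allFin a) λ {i} _ i≢a →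
        when-no (atMin? i (block π k)) λ (mi , eq) →
          i≢a (Min-unique π mi ma (~-trans π (≡⇒~ π (sym eq)) (~-sym π a~k))))
      (when-yes (atMin? a (block π k)) (ma , ~⇒≡ π a~k))

  fold-point : ∀ (W : Subset n) F →
    fold (allFin ∣ W ∣) (F ∘ point W) ≈ fold (allFin n) λ i → when (i ∈? W) (F i)
  fold-point Vec.[] F = ≈-refl
  fold-point {n = suc n} (inside Vec.∷ W) F = begin
    fold (allFin (suc ∣ W ∣)) (F ∘ point (inside Vec.∷ W))
      ≡⟨ fold-allFin-suc (F ∘ point (inside Vec.∷ W)) ⟩
    F zero ∙ fold (allFin ∣ W ∣) (F ∘ suc ∘ point W)
      ≈⟨ ∙-congˡ (fold-point W (F ∘ suc)) ⟩
    F zero ∙ fold (allFin n) (λ i → when (i ∈? W) (F (suc i)))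
      ≡⟨ fold-allFin-suc (λ i → when (i ∈? (inside Vec.∷ W)) (F i)) ⟨
    fold (allFin (suc n)) (λ i → when (i ∈? (inside Vec.∷ W)) (F i)) ∎
  fold-point {n = suc n} (outside Vec.∷ W) F = begin
    fold (allFin ∣ W ∣) (F ∘ suc ∘ point W)
      ≈⟨ fold-point W (F ∘ suc) ⟩
    fold (allFin n) (λ i → when (i ∈? W) (F (suc i)))
      ≈⟨ identityˡ _ ⟨
    ε ∙ fold (allFin n) (λ i → when (i ∈? W) (F (suc i)))
      ≡⟨ fold-allFin-suc (λ i → when (i ∈? (outside Vec.∷ W)) (F i)) ⟨
    fold (allFin (suc n)) (λ i → when (i ∈? (outside Vec.∷ W)) (F i)) ∎

  -- The blocks cover every point exactly once, so exchanging the two folds leaves a single term for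
  -- each point.
  fold-blocks-points : ∀ (σ : NC n) F →
    fold (blocks σ) (λ W → fold (allFin ∣ W ∣) (F ∘ point W)) ≈ fold (allFin n) F
  fold-blocks-points {n} σ F = begin
    fold (blocks σ) (λ W → fold (allFin ∣ W ∣) (F ∘ point W))
      ≈⟨ fold-cong (blocks σ) (λ W → fold-point W F) ⟩
    fold (blocks σ) (λ W → fold (allFin n) λ i → when (i ∈? W) (F i))
      ≈⟨ fold-swap (blocks σ) (allFin n) _ ⟩
    fold (allFin n) (λ i → fold (blocks σ) λ W → when (i ∈? W) (F i))
      ≈⟨ fold-cong (allFin n) (λ i → ≈-trans
           (fold-single (blocks-unique σ) (∈-blocks⁺ σ i) (λ {W} W∈ W≢ →
             when-no (i ∈? W) (W≢ ∘ only (∈-blocks⁻ σ W∈))))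
           (when-yes (i ∈? block σ i) (~-refl σ))) ⟩
    fold (allFin n) F ∎
    where
    only : ∀ {W i} → (∃ λ k → W ≡ block σ k) → i ∈ W → W ≡ block σ i
    only (k , refl) k~i = sym (~⇒≡ σ k~i)

-- Sums and products in the ring.

module Convolution {c ℓ} (R : CommutativeRing c ℓ) where

  open CommutativeRing R hiding (zero)
    renaming (refl to ≈-refl; sym to ≈-sym; trans to ≈-trans)
  open Functions R
  open import Relation.Binary.Reasoning.Setoid setoid

  module Sum where
    open Fold +-commutativeMonoid public
    open FoldNC +-commutativeMonoid public
  module Product where
    open Fold *-commutativeMonoid public
    open FoldNC *-commutativeMonoid public

  ∑-distribˡ : ∀ {a} {A : Set a} x (ys : List A) f → x * ∑ ys f ≈ ∑ ys λ y → x * f y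
  ∑-distribˡ x []       f = zeroʳ x
  ∑-distribˡ x (y ∷ ys) f = ≈-trans (distribˡ x _ _) (+-congˡ (∑-distribˡ x ys f))

  ∑-distribʳ : ∀ {a} {A : Set a} x (ys : List A) f → ∑ ys f * x ≈ ∑ ys λ y → f y * x
  ∑-distribʳ x []       f = zeroˡ x
  ∑-distribʳ x (y ∷ ys) f = ≈-trans (distribʳ x _ _) (+-congˡ (∑-distribʳ x ys f))

  ∏-zero : ∀ {a} {A : Set a} {x} {xs : List A} {f} → x ∈ˡ xs → f x ≈ 0# → ∏ xs f ≈ 0#
  ∏-zero (here refl) fx≈0 = ≈-trans (*-congʳ fx≈0) (zeroˡ _)
  ∏-zero (there x∈)    fx≈0 = ≈-trans (*-congˡ (∏-zero x∈ fx≈0)) (zeroʳ _)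

  ^-∏ : ∀ {a} {A : Set a} x (ys : List A) → x ^ length ys ≈ ∏ ys λ _ → x
  ^-∏ x []       = ≈-refl
  ^-∏ x (y ∷ ys) = *-congˡ (^-∏ x ys)

  -- The expansion of a product of `n` binomials: `A` records the factors from which the first
  -- summand is chosen. The induction splits off the choice at `zero`.
  ∑-subsets : ∀ n (w : Fin n → Bool → Carrier) →
    ∑ (subsets n) (λ A → ∏ (allFin n) λ i → w i (lookup A i)) ≈
    ∏ (allFin n) λ i → w i inside + w i outside
  ∑-subsets zero    w = +-identityʳ _
  ∑-subsets (suc n) w = begin
    ∑ (subsets (suc n)) (λ A → ∏ (allFin (suc n)) λ i → w i (lookup A i))
      ≈⟨ Sum.fold-cartesianProductWith Vec._∷_ bools (subsets n) _ ⟩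
    ∑ bools (λ x → ∑ (subsets n) λ A → ∏ (allFin (suc n)) λ i → w i (lookup (x Vec.∷ A) i))
      ≈⟨ Sum.fold-cong bools (λ x → begin
           ∑ (subsets n) (λ A → ∏ (allFin (suc n)) λ i → w i (lookup (x Vec.∷ A) i))
             ≈⟨ Sum.fold-cong (subsets n) (λ A →
                  reflexive (Product.fold-allFin-suc λ i → w i (lookup (x Vec.∷ A) i))) ⟩
           ∑ (subsets n) (λ A → w zero x * ∏ (allFin n) λ i → w (suc i) (lookup A i))
             ≈⟨ ∑-distribˡ (w zero x) (subsets n) _ ⟨
           w zero x * ∑ (subsets n) (λ A → ∏ (allFin n) λ i → w (suc i) (lookup A i))
             ≈⟨ *-congˡ (∑-subsets n (w ∘ suc)) ⟩
           w zero x * rest ∎) ⟩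
    ∑ bools (λ x → w zero x * rest)
      ≈⟨ ∑-distribʳ rest bools (w zero) ⟨
    ∑ bools (w zero) * rest
      ≈⟨ *-congʳ (+-congˡ (+-identityʳ _)) ⟩
    (w zero inside + w zero outside) * rest
      ≡⟨ Product.fold-allFin-suc (λ i → w i inside + w i outside) ⟨
    ∏ (allFin (suc n)) (λ i → w i inside + w i outside) ∎
    where
    bools : List Bool
    bools = inside ∷ outside ∷ []
    rest : Carrier
    rest = ∏ (allFin n) λ i → w (suc i) inside + w (suc i) outside

  -- Algebra of convolution.

  ⋆-congˡ : ∀ {f f′ : Fun} (g : Fun) → f ≗ f′ → (f ⋆ g) ≗ (f′ ⋆ g)
  ⋆-congˡ {f} {f′} g f≗f′ {n} π σ _ =
    Sum.fold-cong (allNC n) λ ρ → term ρ (π ≤? ρ) (ρ ≤? σ)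
    where
    term : ∀ ρ d e → ⋆-term f g π ρ σ d e ≈ ⋆-term f′ g π ρ σ d e
    term ρ (yes π≤ρ) (yes _) = *-congʳ (f≗f′ π ρ π≤ρ)
    term ρ (yes _)   (no _)  = ≈-refl
    term ρ (no _)    _       = ≈-refl

  ⋆-congʳ : ∀ (f : Fun) {g g′ : Fun} → g ≗ g′ → (f ⋆ g) ≗ (f ⋆ g′)
  ⋆-congʳ f {g} {g′} g≗g′ {n} π σ _ =
    Sum.fold-cong (allNC n) λ ρ → term ρ (π ≤? ρ) (ρ ≤? σ)
    where
    term : ∀ ρ d e → ⋆-term f g π ρ σ d e ≈ ⋆-term f g′ π ρ σ d e
    term ρ (yes _) (yes ρ≤σ) = *-congˡ (g≗g′ ρ σ ρ≤σ)
    term ρ (yes _) (no _)    = ≈-refl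
    term ρ (no _)  _         = ≈-refl

  ⋆-identityʳ : ∀ (f : Fun) (π σ : NC n) .(π≤σ : π ≤ σ) → (f ⋆ δ) π σ π≤σ ≈ f π σ π≤σ
  ⋆-identityʳ f π σ π≤σ = ≈-trans
    (Sum.fold-allNC-single σ _ λ ρ → away ρ (π ≤? ρ) (ρ ≤? σ))
    (at (π ≤? σ) (σ ≤? σ))
    where
    δ-off : ∀ {ρ} .(ρ≤σ : ρ ≤ σ) → ρ ≢ σ → δ ρ σ ρ≤σ ≈ 0#
    δ-off {ρ} _ ρ≢σ = Sum.when-no (ρ ≟ᴺ σ) ρ≢σ
    away : ∀ ρ d e → ρ ≢ σ → ⋆-term f δ π ρ σ d e ≈ 0#
    away ρ (yes _) (yes ρ≤σ) ρ≢σ = ≈-trans (*-congˡ (δ-off ρ≤σ ρ≢σ)) (zeroʳ _)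
    away ρ (yes _) (no _)    ρ≢σ = ≈-refl
    away ρ (no _)  _         ρ≢σ = ≈-refl
    at : ∀ d e → ⋆-term f δ π σ σ d e ≈ f π σ π≤σ
    at (yes _) (yes _) =
      ≈-trans (*-congˡ (Sum.when-yes (σ ≟ᴺ σ) refl)) (*-identityʳ _)
    at (yes _) (no σ≰σ) = contradiction (≤-refl σ) σ≰σ
    at (no π≰σ) _       = contradiction-irr π≤σ π≰σ

  -- Both sides are the sum over chains π ≤ τ ≤ ρ ≤ σ, with `triple` as the term of one chain.
  -- Transitivity shows that a missing outer relation leaves no chain.
  ⋆-assoc : ∀ (f g h : Fun) (π σ : NC n) .(π≤σ : π ≤ σ) →
            ((f ⋆ g) ⋆ h) π σ π≤σ ≈ (f ⋆ (g ⋆ h)) π σ π≤σ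
  ⋆-assoc {n} f g h π σ _ = begin
    ∑ (allNC n) (λ ρ → ⋆-term (f ⋆ g) h π ρ σ (π ≤? ρ) (ρ ≤? σ))
      ≈⟨ Sum.fold-cong (allNC n) (λ ρ → left ρ (π ≤? ρ) (ρ ≤? σ)) ⟩
    ∑ (allNC n) (λ ρ → ∑ (allNC n) λ τ → triple τ ρ (π ≤? τ) (τ ≤? ρ) (ρ ≤? σ))
      ≈⟨ Sum.fold-swap (allNC n) (allNC n) _ ⟩
    ∑ (allNC n) (λ τ → ∑ (allNC n) λ ρ → triple τ ρ (π ≤? τ) (τ ≤? ρ) (ρ ≤? σ))
      ≈⟨ Sum.fold-cong (allNC n) (λ τ → ≈-sym (right τ (π ≤? τ) (τ ≤? σ))) ⟩
    ∑ (allNC n) (λ τ → ⋆-term f (g ⋆ h) π τ σ (π ≤? τ) (τ ≤? σ)) ∎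
    where
    triple : ∀ τ ρ → Dec (π ≤ τ) → Dec (τ ≤ ρ) → Dec (ρ ≤ σ) → Carrier
    triple τ ρ (yes p) (yes q) (yes r) = f π τ p * g τ ρ q * h ρ σ r
    triple τ ρ _       _       _       = 0#

    left : ∀ ρ d k → ⋆-term (f ⋆ g) h π ρ σ d k ≈
                     ∑ (allNC n) λ τ → triple τ ρ (π ≤? τ) (τ ≤? ρ) k
    left ρ (yes p) (yes r) = ≈-trans (∑-distribʳ (h ρ σ r) (allNC n) _)
      (Sum.fold-cong (allNC n) λ τ → term τ (π ≤? τ) (τ ≤? ρ))
      where
      term : ∀ τ d e → ⋆-term f g π τ ρ d e * h ρ σ r ≈ triple τ ρ d e (yes r)
      term τ (yes _) (yes _) = ≈-refl
      term τ (yes _) (no _)  = zeroˡ _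
      term τ (no _)  _       = zeroˡ _
    left ρ (yes p) (no r) = ≈-sym (Sum.fold-ε (allNC n) λ {τ} _ → term τ (π ≤? τ) (τ ≤? ρ))
      where
      term : ∀ τ d e → triple τ ρ d e (no r) ≈ 0#
      term τ (yes _) (yes _) = ≈-refl
      term τ (yes _) (no _)  = ≈-refl
      term τ (no _)  _       = ≈-refl
    left ρ (no ¬p) k = ≈-sym (Sum.fold-ε (allNC n) λ {τ} _ → term τ (π ≤? τ) (τ ≤? ρ) k)
      where
      term : ∀ τ d e k → triple τ ρ d e k ≈ 0#
      term τ (yes p) (yes q) _ = contradiction (≤-trans π τ ρ p q) ¬p
      term τ (yes _) (no _)  _ = ≈-refl
      term τ (no _)  _       _ = ≈-refl

    right : ∀ τ d k → ⋆-term f (g ⋆ h) π τ σ d k ≈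
                      ∑ (allNC n) λ ρ → triple τ ρ d (τ ≤? ρ) (ρ ≤? σ)
    right τ (yes p) (yes r) = ≈-trans (∑-distribˡ (f π τ p) (allNC n) _)
      (Sum.fold-cong (allNC n) λ ρ → term ρ (τ ≤? ρ) (ρ ≤? σ))
      where
      term : ∀ ρ d e → f π τ p * ⋆-term g h τ ρ σ d e ≈ triple τ ρ (yes p) d e
      term ρ (yes _) (yes _) = ≈-sym (*-assoc _ _ _)
      term ρ (yes _) (no _)  = zeroʳ _
      term ρ (no _)  _       = zeroʳ _
    right τ (yes p) (no ¬r) = ≈-sym (Sum.fold-ε (allNC n) λ {ρ} _ → term ρ (τ ≤? ρ) (ρ ≤? σ))
      where
      term : ∀ ρ d e → triple τ ρ (yes p) d e ≈ 0#
      term ρ (yes q) (yes r) = contradiction (≤-trans τ ρ σ q r) ¬r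
      term ρ (yes _) (no _)  = ≈-refl
      term ρ (no _)  _       = ≈-refl
    right τ (no ¬p) k = ≈-sym (Sum.fold-ε (allNC n) λ _ → ≈-refl)

  -- Values of the cumulant-to-moment functions on all pairs.

  ^-inner : ∀ t (π : NC n) →
    t ^ inner π ≈ ∏ (allFin n) λ i →
      Product.when (min? π i ×-dec isInner? π (block π i)) t
  ^-inner {n} t π = begin
    t ^ inner π
      ≈⟨ ^-∏ t (filter (isInner? π) (blocks π)) ⟩
    ∏ (filter (isInner? π) (blocks π)) (λ _ → t)
      ≈⟨ Product.fold-filter (isInner? π) (blocks π) _ ⟩
    ∏ (blocks π) (λ V → Product.when (isInner? π V) t)
      ≈⟨ Product.fold-blocks π _ ⟩
    ∏ (allFin n) (λ i → Product.when (min? π i) (Product.when (isInner? π (block π i)) t))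
      ≈⟨ Product.fold-cong (allFin n) (λ i → Product.when-× (min? π i) (isInner? π (block π i)) t) ⟩
    ∏ (allFin n) (λ i → Product.when (min? π i ×-dec isInner? π (block π i)) t) ∎

  module _ {t : Carrier} {g : Fun} (G : IsBooleanCumulantToMoment t g) where

    open IsBooleanCumulantToMoment G
    open IsMultiplicative isMultiplicative

    -- Multiplicativity gives a power of `t` for each block of σ, with the number of inner blocks of
    -- the restriction as exponent. By `↾-InnerMin` these powers are products over the points of the
    -- block, and the blocks of σ partition all points.
    value : ∀ .{{_ : NonZero n}} (π σ : NC n) (π≤σ : π ≤ σ) →
            g π σ π≤σ ≈ ∏ (allFin n) λ i → Product.when (innerMin? π σ i) t
    value {n} π σ π≤σ = begin
      g π σ π≤σ
        ≈⟨ factors π σ π≤σ ⟩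
      ∏ (blocks σ) (λ W → g (π ↾ W) 1ₙ (≤-1ₙ (π ↾ W)))
        ≈⟨ Product.fold-cong-∈ (blocks σ) (λ W∈ → factor (∈-blocks⁻ σ W∈)) ⟩
      ∏ (blocks σ) (λ W → ∏ (allFin ∣ W ∣) (F ∘ point W))
        ≈⟨ Product.fold-blocks-points σ F ⟩
      ∏ (allFin n) F ∎
      where
      F : Fin n → Carrier
      F i = Product.when (innerMin? π σ i) t

      factor : ∀ {W} → (∃ λ k → W ≡ block σ k) →
               g (π ↾ W) 1ₙ (≤-1ₙ (π ↾ W)) ≈ ∏ (allFin ∣ W ∣) (F ∘ point W)
      factor (k , refl) = begin
        g (π ↾ W) 1ₙ (≤-1ₙ (π ↾ W))
          -- The block contains `k`, so its size is nonzero and the prescribed value applies.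
          ≈⟨ top-value {{Fin.nonZeroIndex (proj₁ (point-surjective W (~-refl σ {k})))}} (π ↾ W) ⟩
        t ^ inner (π ↾ W)
          ≈⟨ ^-inner t (π ↾ W) ⟩
        ∏ (allFin ∣ W ∣) (λ j → Product.when
          (min? (π ↾ W) j ×-dec isInner? (π ↾ W) (block (π ↾ W) j)) t)
          ≈⟨ Product.fold-cong (allFin ∣ W ∣) (λ j → Product.when-⇔
               (↾-InnerMin π σ π≤σ k j) (min? (π ↾ W) j ×-dec isInner? (π ↾ W) (block (π ↾ W) j))
               (innerMin? π σ (point W j)) t) ⟩
        ∏ (allFin ∣ W ∣) (F ∘ point W) ∎
        where
        W : Subset n
        W = block σ k

  -- The quotient function and its convolution with `gₜ`.

  mergedSet : NC n → NC n → Subset n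
  mergedSet π ρ = tabulate (does ∘ merged? π ρ)

  -- For π ≪ ρ the product is u ^ (|π| − |ρ|), the minima of the blocks of ρ
  -- being those minima of blocks of π that are not merged.

  quotient : Carrier → Fun
  quotient u {n} π ρ _ =
    Sum.when (π ≪? ρ) (∏ (allFin n) λ i → Product.when (merged? π ρ i) u)

  module _ (s t : Carrier) (π σ : NC n) (π≤σ : π ≤ σ) where

    private
      u : Carrier
      u = s - t

    -- Only inner blocks can be merged, so for any other block merging has
    -- weight 0 and keeping it has weight 1.
    weight : Fin n → Bool → Carrier
    weight i merged = if does (innerMin? π σ i)
      then (if merged then u else t) else (if merged then 0# else 1#)

    weights : Subset n → Carrier
    weights A = ∏ (allFin n) λ i → weight i (lookup A i)

    u+t≈s : u + t ≈ s
    u+t≈s = begin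
      s + - t + t   ≈⟨ +-assoc s (- t) t ⟩
      s + (- t + t) ≈⟨ +-congˡ (-‿inverseˡ t) ⟩
      s + 0#        ≈⟨ +-identityʳ s ⟩
      s             ∎

    -- After expansion, an inner minimum contributes the factor u + t = s and every other point the
    -- factor 0 + 1.
    ∑-weights : ∑ (subsets n) weights ≈
                ∏ (allFin n) λ i → Product.when (innerMin? π σ i) s
    ∑-weights = ≈-trans (∑-subsets n weight) (Product.fold-cong (allFin n) total)
      where
      total : ∀ i → weight i inside + weight i outside ≈ Product.when (innerMin? π σ i) s
      total i with does (innerMin? π σ i)
      ... | true  = u+t≈s
      ... | false = +-identityˡ 1#

    weights-zero : ∀ {A i} → i ∈ A → ¬ InnerMin π σ i → weights A ≈ 0#
    weights-zero {A} {i} i∈A ¬I = ∏-zero (∈-allFin i) factor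
      where
      factor : weight i (lookup A i) ≈ 0#
      factor rewrite []=⇒lookup i∈A = if-no (innerMin? π σ i)
        where
        if-no : (I? : Dec (InnerMin π σ i)) → (if does I? then u else 0#) ≈ 0#
        if-no (yes I) = contradiction I ¬I
        if-no (no _)  = ≈-refl

    -- The factors agree point by point. A merged minimum is inner for π and no longer a minimum of
    -- ρ, which gives `u`. An inner minimum of π that is not merged is a minimum of ρ and still
    -- inner, which gives `t`. All other points give 1.
    weights-mergedSet : ∀ {ρ} → Merges π σ ρ →
      ∏ (allFin n) (λ i → Product.when (merged? π ρ i) u) *
      ∏ (allFin n) (λ i → Product.when (innerMin? ρ σ i) t) ≈ weights (mergedSet π ρ)
    weights-mergedSet {ρ} m = ≈-trans (≈-sym (Product.fold-∙ (allFin n) _ _))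
      (Product.fold-cong (allFin n) factor)
      where
      factor : ∀ i → Product.when (merged? π ρ i) u * Product.when (innerMin? ρ σ i) t ≈
                     weight i (lookup (mergedSet π ρ) i)
      factor i rewrite lookup∘tabulate (does ∘ merged? π ρ) i
        with merged? π ρ i | innerMin? π σ i | innerMin? ρ σ i
      ... | yes (_ , ¬mi) | _      | yes (mi , _) = contradiction mi ¬mi
      ... | yes M         | no ¬I  | no _         = contradiction (Merged⇒InnerMin π σ ρ m M) ¬I
      ... | yes M         | yes _  | no _         = *-identityʳ u
      ... | no _          | yes _  | yes _        = *-identityˡ t
      ... | no _          | no ¬I  | yes I        = contradiction (InnerMin-↓ π σ ρ m I) ¬I
      ... | no _          | no _   | no _         = *-identityˡ 1#
      ... | no ¬M         | yes I  | no ¬I        = contradiction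
        (InnerMin-↑ π σ ρ m (decidable-stable (min? ρ i) λ ¬mi → ¬M (proj₁ I , ¬mi)) I) ¬I

    -- When π ≤ ρ, the minima of ρ are the minima of π outside the merged set, so equal merged sets
    -- lead to equal minima.
    mergedSet⇒Min : ∀ {ρ ρ′} → π ≤ ρ → mergedSet π ρ ≡ mergedSet π ρ′ →
                    ∀ {i} → Min ρ i → Min ρ′ i
    mergedSet⇒Min {ρ} {ρ′} π≤ρ eq {i} mi = decidable-stable (min? ρ′ i) λ ¬mi →
      proj₂ (∈-tabulate⁻ (merged? π ρ) (subst (i ∈_) (sym eq)
        (∈-tabulate⁺ (merged? π ρ′) (Min-≤ π ρ π≤ρ mi , ¬mi)))) mi

    mergesVia? : ∀ ρ A → Dec (Merges π σ ρ × A ≡ mergedSet π ρ)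
    mergesVia? ρ A = merges? π σ ρ ×-dec (A ≟ˢ mergedSet π ρ)

    -- If `A` consists of inner minima, exactly one ρ has `A` as merged set, namely `merge`.
    -- Otherwise `A` contains a point that is not an inner minimum, its weight is zero, and so is
    -- every term.
    ∑-mergesVia : ∀ A → ∑ (allNC n) (λ ρ → Sum.when (mergesVia? ρ A) (weights A)) ≈ weights A
    ∑-mergesVia A with Fin.all? (λ i → (i ∈? A) →-dec innerMin? π σ i)
    ... | yes A⊆I = ≈-trans
      (Sum.fold-allNC-single merge _ λ τ τ≢merge → Sum.when-no (mergesVia? τ A)
        λ (m , A≡) → τ≢merge (unique m (trans (sym A≡) A≡mergedSet)))
      (Sum.when-yes (mergesVia? merge A) (merges , A≡mergedSet))
      where
      open Merge π σ π≤σ A (A⊆I _)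
      A≡mergedSet : A ≡ mergedSet π merge
      A≡mergedSet = ⊆-antisym (λ i∈A → ∈-tabulate⁺ (merged? π merge) (∈⇒Merged i∈A))
                              (λ i∈ → Merged⇒∈ (∈-tabulate⁻ (merged? π merge) i∈))
      unique : ∀ {τ} → Merges π σ τ → mergedSet π τ ≡ mergedSet π merge → τ ≡ merge
      unique {τ} m eq = merges-unique π σ τ merge m merges
        (mergedSet⇒Min (Merges.π≤ρ m) eq) (mergedSet⇒Min π≤merge (sym eq))
    ... | no A⊈I with i , ¬i ← Fin.¬∀⟶∃¬ n _ (λ i → (i ∈? A) →-dec innerMin? π σ i) A⊈I =
      ≈-trans (Sum.fold-ε (allNC n) λ {ρ} _ → vanishes (mergesVia? ρ A))
            (≈-sym weights≈0)
      where
      weights≈0 : weights A ≈ 0#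
      weights≈0 = weights-zero {A} {i}
        (decidable-stable (i ∈? A) λ i∉A → ¬i λ i∈A → contradiction i∈A i∉A)
        (λ I → ¬i λ _ → I)
      vanishes : ∀ {P : Set} (P? : Dec P) → Sum.when P? (weights A) ≈ 0#
      vanishes (yes _) = weights≈0
      vanishes (no _)  = ≈-refl

    -- Double counting of the pairs of a ρ and its merged set `A`: summing over `A` first gives the
    -- left side, summing over ρ first the right side.
    ∑-merges : ∑ (allNC n) (λ ρ → Sum.when (merges? π σ ρ) (weights (mergedSet π ρ))) ≈
               ∑ (subsets n) weights
    ∑-merges = begin
      ∑ (allNC n) (λ ρ → Sum.when (merges? π σ ρ) (weights (mergedSet π ρ)))
        ≈⟨ Sum.fold-cong (allNC n) (λ ρ → ≈-sym (via ρ)) ⟩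
      ∑ (allNC n) (λ ρ → ∑ (subsets n) λ A → Sum.when (mergesVia? ρ A) (weights A))
        ≈⟨ Sum.fold-swap (allNC n) (subsets n) _ ⟩
      ∑ (subsets n) (λ A → ∑ (allNC n) λ ρ → Sum.when (mergesVia? ρ A) (weights A))
        ≈⟨ Sum.fold-cong (subsets n) ∑-mergesVia ⟩
      ∑ (subsets n) weights ∎
      where
      via : ∀ ρ → ∑ (subsets n) (λ A → Sum.when (mergesVia? ρ A) (weights A)) ≈
                  Sum.when (merges? π σ ρ) (weights (mergedSet π ρ))
      via ρ = ≈-trans
        (Sum.fold-single (subsets-unique n) (∈-subsets (mergedSet π ρ))
          λ {A} _ A≢ → Sum.when-no (mergesVia? ρ A) (A≢ ∘ proj₂))
        (Sum.when-⇔ (mk⇔ proj₁ (_, refl)) (mergesVia? ρ (mergedSet π ρ)) (merges? π σ ρ) _)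

    -- The terms with `π ≪ ρ` are the weights of merged sets and the others vanish. Reindexing by
    -- subsets and expanding the product then gives the value of `gₛ`.
    quotient-⋆ : ∀ {gₛ gₜ : Fun} .{{_ : NonZero n}} →
      IsBooleanCumulantToMoment s gₛ → IsBooleanCumulantToMoment t gₜ →
      (quotient u ⋆ gₜ) π σ π≤σ ≈ gₛ π σ π≤σ
    quotient-⋆ {gₛ} {gₜ} Gₛ Gₜ = begin
      (quotient u ⋆ gₜ) π σ π≤σ
        ≈⟨ Sum.fold-cong (allNC n) (λ ρ → term ρ (π ≤? ρ) (ρ ≤? σ)) ⟩
      ∑ (allNC n) (λ ρ → Sum.when (merges? π σ ρ) (weights (mergedSet π ρ)))
        ≈⟨ ∑-merges ⟩
      ∑ (subsets n) weights
        ≈⟨ ∑-weights ⟩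
      ∏ (allFin n) (λ i → Product.when (innerMin? π σ i) s)
        ≈⟨ value Gₛ π σ π≤σ ⟨
      gₛ π σ π≤σ ∎
      where
      open Merges
      term : ∀ ρ d e → ⋆-term (quotient u) gₜ π ρ σ d e ≈
                       Sum.when (merges? π σ ρ) (weights (mergedSet π ρ))
      term ρ (no π≰ρ) _ = ≈-sym (Sum.when-no (merges? π σ ρ) (π≰ρ ∘ π≤ρ))
      term ρ (yes _) (no ρ≰σ) = ≈-sym (Sum.when-no (merges? π σ ρ) (ρ≰σ ∘ ρ≤σ))
      term ρ (yes p) (yes q) = by (π ≪? ρ)
        where
        by : Dec (π ≪ ρ) → quotient u π ρ p * gₜ ρ σ q ≈
                           Sum.when (merges? π σ ρ) (weights (mergedSet π ρ))
        by (yes r) = begin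
          quotient u π ρ p * gₜ ρ σ q
            ≈⟨ *-cong (Sum.when-yes (π ≪? ρ) r) (value Gₜ ρ σ q) ⟩
          ∏ (allFin n) (λ i → Product.when (merged? π ρ i) u) *
          ∏ (allFin n) (λ i → Product.when (innerMin? ρ σ i) t)
            ≈⟨ weights-mergedSet (mkMerges p q r) ⟩
          weights (mergedSet π ρ)
            ≈⟨ Sum.when-yes (merges? π σ ρ) (mkMerges p q r) ⟨
          Sum.when (merges? π σ ρ) (weights (mergedSet π ρ)) ∎
        by (no ¬r) = begin
          quotient u π ρ p * gₜ ρ σ q
            ≈⟨ *-congʳ (Sum.when-no (π ≪? ρ) ¬r) ⟩
          0# * gₜ ρ σ q
            ≈⟨ zeroˡ _ ⟩
          0#
            ≈⟨ Sum.when-no (merges? π σ ρ) (¬r ∘ π≪ρ) ⟨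
          Sum.when (merges? π σ ρ) (weights (mergedSet π ρ)) ∎

  -- The quotient function at the one-block partition.

  ~-1ₙ : ∀ (i j : Fin n) → i ~[ 1ₙ ] j
  ~-1ₙ i j = subst (j ∈_) (sym (lookup-replicate i ⊤)) ∈⊤

  -- The only minimum of `1ₙ` is `zero`, and its π-hull covers all points exactly when the last
  -- point is in its π-block.
  ≪-1ₙ : (π : NC (suc n)) → π ≪ 1ₙ ⇔ Irreducible π
  ≪-1ₙ {n} π = mk⇔ to from
    where
    to : π ≪ 1ₙ → Irreducible π
    to π≪1 with _ , d , n≤d , 0~d ← π≪1 zero (fromℕ n) (λ _ _ → z≤n) (~-1ₙ zero _) =
      subst (zero ~[ π ]_) (Fin.≤-antisym (Fin.≤fromℕ d) n≤d) 0~d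
    from : Irreducible π → π ≪ 1ₙ
    -- A minimum of `1ₙ` is at most `zero`, which leaves only the case `i = zero`.
    from 0~n i j mi _ with ℕ.n≤0⇒n≡0 (mi zero (~-1ₙ i zero))
    from 0~n zero j mi _ | _ = z≤n , fromℕ n , Fin.≤fromℕ j , 0~n

  -- The first block in the list is the one through `zero`, and it accounts for the subtracted 1.
  -- The remaining blocks avoid `zero`, so their minima are exactly the minima of π that are merged
  -- in `1ₙ`.
  ^-#blocks : ∀ u (π : NC (suc n)) →
    u ^ (#blocks π ∸ 1) ≈ ∏ (allFin (suc n)) λ i → Product.when (merged? π 1ₙ i) u
  ^-#blocks {n} u π@(mkNC (b Vec.∷ bs) _) = begin
    u ^ length others
      ≈⟨ ^-∏ u others ⟩
    ∏ others (λ _ → u)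
      ≈⟨ Product.fold-cong-∈ others (λ V∈ → ≈-sym (Product.when-yes (¬? (zero ∈? _)) (0∉ V∈))) ⟩
    ∏ others G
      ≈⟨ *-identityˡ _ ⟨
    1# * ∏ others G
      ≈⟨ *-congʳ (Product.when-no (¬? (zero ∈? b)) λ 0∉b → 0∉b (~-refl π {zero})) ⟨
    ∏ (blocks π) G
      ≈⟨ Product.fold-blocks π G ⟩
    ∏ (allFin (suc n)) (λ i → Product.when (min? π i) (G (block π i)))
      ≈⟨ Product.fold-cong (allFin (suc n)) (λ i → ≈-trans
           (Product.when-× (min? π i) (¬? (zero ∈? block π i)) u)
           (Product.when-⇔ (merged i) (min? π i ×-dec ¬? (zero ∈? block π i)) (merged? π 1ₙ i) u)) ⟩
    ∏ (allFin (suc n)) (λ i → Product.when (merged? π 1ₙ i) u) ∎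
    where
    others : List (Subset (suc n))
    others = List.drop 1 (blocks π)

    G : Subset (suc n) → Carrier
    G V = Product.when (¬? (zero ∈? V)) u

    0∉ : ∀ {V} → V ∈ˡ others → ¬ zero ∈ V
    0∉ V∈ 0∈V with b∉ ∷ _ ← blocks-unique π | k , refl ← ∈-blocks⁻ π (there V∈) =
      All.lookup b∉ V∈ (~⇒≡ π {k} 0∈V)

    merged : ∀ i → (Min π i × ¬ zero ∈ block π i) ⇔ Merged π 1ₙ i
    merged i = mk⇔
      (λ (mi , i≁0) → mi , λ m → i≁0
        (subst (_~[ π ] zero) (Fin.≤-antisym z≤n (m zero (~-1ₙ i zero))) (~-refl π {zero})))
      (λ (mi , ¬m) → mi , λ i~0 → ¬m λ j _ → ℕ.≤-trans (mi zero i~0) z≤n)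

  quotient-1ₙ : ∀ u (π : NC (suc n)) →
    quotient u π 1ₙ (≤-1ₙ π) ≈ (if does (irreducible? π) then u ^ (#blocks π ∸ 1) else 0#)
  quotient-1ₙ u π = ≈-trans
    (Sum.when-⇔ (≪-1ₙ π) (π ≪? 1ₙ) (irreducible? π) _)
    (Sum.when-cong (irreducible? π) (≈-sym (^-#blocks u π)))

corollary9p5 : ∀ {c ℓ} (R : CommutativeRing c ℓ) →
    let open CommutativeRing R
        open Functions R in
    (s t : Carrier) (gₛ gₜ gₜ⁻¹ : Fun) →
    IsBooleanCumulantToMoment s gₛ →
    IsBooleanCumulantToMoment t gₜ →
    gₜ⁻¹ IsInverseOf gₜ →
    (n : ℕ) (π : NC (suc n)) →
    (gₛ ⋆ gₜ⁻¹) π 1ₙ (≤-1ₙ π)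
      ≈ (if does (irreducible? π) then (s - t) ^ (#blocks π ∸ 1) else 0#)
corollary9p5 R s t gₛ gₜ gₜ⁻¹ Gₛ Gₜ (_ , gₜ⋆gₜ⁻¹) n π = begin
  (gₛ ⋆ gₜ⁻¹) π 1ₙ π≤1           ≈⟨ ⋆-congˡ gₜ⁻¹ gₛ≗ π 1ₙ π≤1 ⟩
  ((q ⋆ gₜ) ⋆ gₜ⁻¹) π 1ₙ π≤1     ≈⟨ ⋆-assoc q gₜ gₜ⁻¹ π 1ₙ π≤1 ⟩
  (q ⋆ (gₜ ⋆ gₜ⁻¹)) π 1ₙ π≤1     ≈⟨ ⋆-congʳ q gₜ⋆gₜ⁻¹ π 1ₙ π≤1 ⟩
  (q ⋆ δ) π 1ₙ π≤1               ≈⟨ ⋆-identityʳ q π 1ₙ π≤1 ⟩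
  q π 1ₙ π≤1                     ≈⟨ quotient-1ₙ (s - t) π ⟩
  (if does (irreducible? π) then (s - t) ^ (#blocks π ∸ 1) else 0#) ∎
  where
  open CommutativeRing R renaming (sym to ≈-sym)
  open Functions R
  open Convolution R
  open import Relation.Binary.Reasoning.Setoid setoid
  q : Fun
  q = quotient (s - t)
  π≤1 : π ≤ 1ₙ
  π≤1 = ≤-1ₙ π
  gₛ≗ : gₛ ≗ (q ⋆ gₜ)
  -- The relation ρ ≤ σ is given irrelevantly; its decidability recovers a usable proof.
  gₛ≗ ρ σ ρ≤σ = ≈-sym (quotient-⋆ s t ρ σ (recompute (ρ ≤? σ) ρ≤σ) Gₛ Gₜ)
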